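{- For all $\varepsilon>0$ and integers $r\geq 2$, $k\geq 2$ there exist $\rho=\rho(\varepsilon,r,k)>0$, $K=K(\varepsilon,r,k)$ and $n_0$ such that for every graph $G$ of order $n\geq n_0$ the following holds: if $k_r(G)\leq\rho n^r$, then there exists an $\varepsilon$-uniform partition $V(G)=\bigcup_{i=0}^{q}V_i$ with $k\leq q\leq K$ and \[ e(V_i)\leq\varepsilon\binom{|V_i|}{2}\quad\text{for every } i\in[q]. \]
   Context: All graphs are finite and simple. $k_r(G)$ is the number of $r$-cliques of $G$; $e(U)$ is the number of edges of $G[U]$. For disjoint nonempty $A,B\subset V(G)$, $d(A,B)=e(A,B)/(|A||B|)$ with $e(A,B)$ the number of $A$–$B$ edges. A pair $(A,B)$ is $\varepsilon$-uniform if for all $X\subset A$, $Y\subset B$ with $|X|\geq\varepsilon|A|$, $|Y|\geq\varepsilon|B|$ one has $|d(X,Y)-d(A,B)|<\varepsilon$. A partition $V=\bigcup_{i=0}^{q}V_i$ is equitable if $|V_0|<q$ and $|V_1|=\dots=|V_q|$; it is $\varepsilon$-uniform if it is equitable and at most $\varepsilon q^2$ pairs $(V_i,V_j)$, $1\le i<j\le q$, are not $\varepsilon$-uniform. -}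

module Defs where

open import Data.Bool using (Bool; true; false; _∧_; _∨_; not)
open import Data.Nat as ℕ using (ℕ; zero; suc; _<ᵇ_)
open import Data.Fin using (Fin; toℕ; _≟_)
open import Data.Fin.Subset using (Subset; _⊆_; inside; outside) renaming (∣_∣ to card)
open import Data.Vec using (Vec; []; _∷_; lookup; tabulate)
open import Data.List using (List; []; _∷_; map; _++_; filterᵇ; length; allFin; concatMap)
open import Data.Product using (_×_; _,_; Σ; ∃)
open import Data.Integer using (+_)
open import Data.Rational using (ℚ; 0ℚ; _/_; _≤_; _<_; _*_; _-_; ∣_∣; Positive)
open import Relation.Binary.PropositionalEquality using (_≡_)
open import Relation.Nullary.Decidable using (⌊_⌋)

record Graph (n : ℕ) : Set where
  field
    adj    : Fin n → Fin n → Bool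
    sym    : ∀ x y → adj x y ≡ adj y x
    irrefl : ∀ x → adj x x ≡ false
open Graph public

countᵇ : {A : Set} → (A → Bool) → List A → ℕ
countᵇ p xs = length (filterᵇ p xs)

allSubsets : (n : ℕ) → List (Subset n)
allSubsets zero = [] ∷ []
allSubsets (suc n) = map (inside ∷_) (allSubsets n) ++ map (outside ∷_) (allSubsets n)

allPairs : (n : ℕ) → List (Fin n × Fin n)
allPairs n = concatMap (λ x → map (λ y → (x , y)) (allFin n)) (allFin n)

ℕ→ℚ : ℕ → ℚ
ℕ→ℚ m = (+ m) / 1

isCliqueᵇ : {n : ℕ} → Graph n → Subset n → Bool
isCliqueᵇ {n} G S = countᵇ bad (allPairs n) ℕ.≡ᵇ 0
  where
  bad : _ → Bool
  bad (x , y) = lookup S x ∧ lookup S y ∧ not ⌊ x ≟ y ⌋ ∧ not (adj G x y)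

k[_] : (r : ℕ) → {n : ℕ} → Graph n → ℕ
k[ r ] {n} G = countᵇ (λ S → (card S ℕ.≡ᵇ r) ∧ isCliqueᵇ G S) (allSubsets n)

eIn : {n : ℕ} → Graph n → Subset n → ℕ
eIn {n} G U = countᵇ (λ { (x , y) → lookup U x ∧ lookup U y ∧ (toℕ x <ᵇ toℕ y) ∧ adj G x y })
                     (allPairs n)

eBetween : {n : ℕ} → Graph n → Subset n → Subset n → ℕ
eBetween {n} G A B = countᵇ (λ { (x , y) → lookup A x ∧ lookup B y ∧ adj G x y }) (allPairs n)

-- e / m as a rational (the value for m = 0 is irrelevant: only used with nonempty sets)
ratio : ℕ → ℕ → ℚ
ratio e zero    = 0ℚ
ratio e (suc m) = (+ e) / suc m

density : {n : ℕ} → Graph n → Subset n → Subset n → ℚ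
density G A B = ratio (eBetween G A B) (card A ℕ.* card B)

Uniform : {n : ℕ} → Graph n → ℚ → Subset n → Subset n → Set
Uniform G ε A B =
  ∀ X Y → X ⊆ A → Y ⊆ B →
    ε * ℕ→ℚ (card A) ≤ ℕ→ℚ (card X) →
    ε * ℕ→ℚ (card B) ≤ ℕ→ℚ (card Y) →
    ∣ density G X Y - density G A B ∣ < ε

-- partitions V = V_0 ∪ V_1 ∪ … ∪ V_q, given by a class map Fin n → Fin (suc q);
-- class 0 is the exceptional set V_0, class (suc i) is V_{i+1}.

classOf : {n q : ℕ} → (Fin n → Fin (suc q)) → Fin (suc q) → Subset n
classOf part i = tabulate (λ x → ⌊ part x ≟ i ⌋)

part[_] : {n q : ℕ} → (Fin n → Fin (suc q)) → Fin q → Subset n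
part[ part ] i = classOf part (Fin.suc i)
  where import Data.Fin as Fin

-- equitable: |V_0| < q and |V_1| = … = |V_q|  (and, since d(V_i,V_j) is only
-- defined for nonempty sets, the classes V_1,…,V_q are nonempty)
Equitable : {n q : ℕ} → (Fin n → Fin (suc q)) → Set
Equitable {n} {q} part =
  card (classOf part Data.Fin.zero) ℕ.< q ×
  Σ ℕ (λ m → 1 ℕ.≤ m × (∀ i → card (part[ part ] i) ≡ m))

-- ε-uniform partition: equitable, and at most ε q² pairs (V_i,V_j), 1 ≤ i < j ≤ q,
-- are not ε-uniform.  Expressed by a Boolean marking `bad` of pairs: the number of
-- marked pairs i < j is ≤ ε q², and every unmarked pair i < j is ε-uniform.
UniformPartition : {n q : ℕ} → Graph n → ℚ → (Fin n → Fin (suc q)) → Set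
UniformPartition {n} {q} G ε part =
  Equitable part ×
  Σ (Fin q → Fin q → Bool) (λ bad →
      (ℕ→ℚ (countᵇ (λ { (i , j) → (toℕ i <ᵇ toℕ j) ∧ bad i j }) (allPairs q))
         ≤ ε * ℕ→ℚ (q ℕ.* q)) ×
      (∀ i j → toℕ i ℕ.< toℕ j → bad i j ≡ false →
         Uniform G ε (part[ part ] i) (part[ part ] j)))

{-# OPTIONS --safe #-}

-- Adapting the energy-increment proof of the regularity lemma, the adjacency matrix f is
-- approximated by a step function g with values in (1/N)ℕ. Call a pair of classes V_i, V_j of size m
-- irregular if some X ⊆ V_i, Y ⊆ V_j satisfy |e(X,Y) - g_ij |X||Y|| > m²/N; changing g by ±1/N on
-- X × Y then lowers Σ (f - g)² by at least (m/N)². Neither averages nor the Cauchy-Schwarz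
-- inequality are needed, moving vertices to the exceptional class is free, and the diagonal pairs
-- (V_i, V_i) are treated like all others, so the number of classes need not be large. Once few pairs
-- are irregular, a graph with few r-cliques contains, in every large subset of a class, a sparse set
-- of a prescribed size: otherwise one passes to a neighbourhood, where there are few (r-1)-cliques.
-- Almost all of each class is cut into such sparse sets, all of one size, and the few remaining
-- vertices are spread evenly over them. The cut-norm form of regularity survives both operations,
-- since passing to a subset of proportion 1/L costs only a factor L², fixed before N is chosen.

module Submission where

open import Defs hiding (sym)
open import Data.Bool using (Bool; true; false; _∧_; not; if_then_else_)
import Data.Bool as Bool
import Data.Bool.Properties as BP
open import Data.Nat
open import Data.Nat.Properties
open import Data.Nat.Combinatorics using (_C_; nCk+nC[k+1]≡[n+1]C[k+1]; nC1≡n)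
open import Data.Nat.Coprimality using (Coprime; 1-coprimeTo)
open import Data.Nat.DivMod using (m≡m%n+[m/n]*n; m%n<n)
open import Data.Nat.Tactic.RingSolver using (solve-∀)
open import Data.Fin as F using (Fin; zero; suc; combine; quotient; remainder; _↑ˡ_; _↑ʳ_)
import Data.Fin.Properties as FP
open import Data.Fin.Subset using (Subset; inside; outside) renaming (∣_∣ to card; ⊥ to ∅)
open import Data.Fin.Subset.Properties using (∣⊥∣≡0; anySubset?)
import Data.Integer as ℤ
import Data.Integer.Properties as ℤP
open import Data.List as List using (List; []; _∷_; _++_; concatMap; allFin)
open import Data.Product using (Σ; ∃; _×_; _,_; proj₁; proj₂)
open import Data.Rational as ℚ using (ℚ; mkℚ; toℚᵘ; Positive) renaming (_*_ to _*ℚ_; _≤_ to _≤ℚ_)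
import Data.Rational.Properties as ℚP
open import Data.Rational.Unnormalised as ℚᵘ using (mkℚᵘ; *≤*; *<*)
import Data.Rational.Unnormalised.Properties as ℚᵘP
open import Data.Sum using (inj₁; inj₂)
open import Data.Unit using (⊤; tt)
open import Data.Vec using ([]; _∷_; lookup; tabulate; _[_]≔_)
open import Data.Vec.Properties using (lookup-replicate; lookup∘update′; lookup∘tabulate; []=⇒lookup; lookup⇒[]=)
open import Function using (_∘_; id; Equivalence)
open import Relation.Nullary using (¬_; Dec; yes; no; contradiction)
open import Relation.Nullary.Decidable using (⌊_⌋; _×-dec_; _→-dec_; ¬?)
open import Relation.Binary.PropositionalEquality hiding ([_])
open import Algebra.Properties.AbelianGroup ℚP.+-0-abelianGroup using (⁻¹-anti-homo‿-)
import Algebra.Properties.Semiring.Sum +-*-semiring as Sum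

-- The choice of constants threatens to be circular: the precision `1/N` has to beat the proportion
-- `1/L` of the later cutting, while the number of classes grows with `N`. The circle is avoided
-- because the cutting ignores the number of classes: `sparse-set` asks only for a set `sparseM`
-- times as large as the sparse set to be found, a factor depending on ε and r alone. The number of
-- classes affects only how many cliques are admissible, and ρ, chosen last, absorbs it. Vertices
-- move to the exceptional class at no cost because `approx` lives on all pairs of vertices and has
-- to be constant only on products of ordinary classes; such a move leaves `approx`, and with it the
-- energy, as it was. During the iteration the exceptional class is controlled only as a fraction of
-- n. The much stronger bound by the number of classes appears at the very end, from a division with
-- remainder.

private variable
  k n q κ : ℕ
  Elt Elt′ : Set

-- Indicators and finite sums

𝟙 : Bool → ℕ
𝟙 true  = 1
𝟙 false = 0

𝟙≤1 : ∀ b → 𝟙 b ≤ 1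
𝟙≤1 true  = ≤-refl
𝟙≤1 false = z≤n

𝟙-∧ : ∀ a b → 𝟙 (a ∧ b) ≡ 𝟙 a * 𝟙 b
𝟙-∧ true  b = sym (+-identityʳ (𝟙 b))
𝟙-∧ false b = refl

𝟙-mono : ∀ {a b} → (a ≡ true → b ≡ true) → 𝟙 a ≤ 𝟙 b
𝟙-mono {false} _ = z≤n
𝟙-mono {true}  f rewrite f refl = ≤-refl

∧-intro : ∀ {a b} → a ≡ true → b ≡ true → a ∧ b ≡ true
∧-intro refl refl = refl

∧-elimˡ : ∀ {a b} → a ∧ b ≡ true → a ≡ true
∧-elimˡ {true} _ = refl

∧-elimʳ : ∀ {a b} → a ∧ b ≡ true → b ≡ true
∧-elimʳ {true} h = h

not-true⇒false : ∀ {a} → not a ≡ true → a ≡ false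
not-true⇒false {false} _ = refl

⌊⌋-true : ∀ {A : Set} {d : Dec A} → ⌊ d ⌋ ≡ true → A
⌊⌋-true {d = yes a} _ = a

true-⌊⌋ : ∀ {A : Set} {d : Dec A} → A → ⌊ d ⌋ ≡ true
true-⌊⌋ {d = yes _} _ = refl
true-⌊⌋ {d = no ¬a} a = contradiction a ¬a

-- Opaque, so that unification treats sums as neutral terms.
opaque
  sum : (Fin n → ℕ) → ℕ
  sum = Sum.sum

  sum-[] : (f : Fin 0 → ℕ) → sum f ≡ 0
  sum-[] f = refl

  sum-∷ : (f : Fin (suc n) → ℕ) → sum f ≡ f zero + sum (f ∘ suc)
  sum-∷ f = refl

  sum-cong : {f g : Fin n → ℕ} → (∀ i → f i ≡ g i) → sum f ≡ sum g
  sum-cong = Sum.sum-cong-≗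

  sum-+ : (f g : Fin n → ℕ) → sum (λ i → f i + g i) ≡ sum f + sum g
  sum-+ = Sum.∑-distrib-+

  sum-swap : (f : Fin k → Fin n → ℕ) → sum (λ x → sum λ y → f x y) ≡ sum (λ y → sum λ x → f x y)
  sum-swap = Sum.∑-comm

  sum-*ˡ : ∀ c (f : Fin n → ℕ) → sum (λ i → c * f i) ≡ c * sum f
  sum-*ˡ c f = sym (Sum.*-distribˡ-sum c f)

  sum-*ʳ : ∀ c (f : Fin n → ℕ) → sum (λ i → f i * c) ≡ sum f * c
  sum-*ʳ c f = sym (Sum.*-distribʳ-sum c f)

  sum-mono : {f g : Fin n → ℕ} → (∀ i → f i ≤ g i) → sum f ≤ sum g
  sum-mono {zero}  h = z≤n
  sum-mono {suc n} h = +-mono-≤ (h zero) (sum-mono (h ∘ suc))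

  sum-const : ∀ n c → sum {n} (λ _ → c) ≡ n * c
  sum-const zero    c = refl
  sum-const (suc n) c = cong (c +_) (sum-const n c)

sum-zero : {f : Fin n → ℕ} → (∀ i → f i ≡ 0) → sum f ≡ 0
sum-zero {n} h = trans (sum-cong h) (trans (sum-const n 0) (*-zeroʳ n))

∑∑ : (Fin k → Fin n → ℕ) → ℕ
∑∑ f = sum λ x → sum (f x)

∑∑-mono : {f g : Fin k → Fin n → ℕ} → (∀ x y → f x y ≤ g x y) → ∑∑ f ≤ ∑∑ g
∑∑-mono h = sum-mono λ x → sum-mono (h x)

∑∑-cong : {f g : Fin k → Fin n → ℕ} → (∀ x y → f x y ≡ g x y) → ∑∑ f ≡ ∑∑ g
∑∑-cong h = sum-cong λ x → sum-cong (h x)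

∑∑-+ : (f g : Fin k → Fin n → ℕ) → ∑∑ (λ x y → f x y + g x y) ≡ ∑∑ f + ∑∑ g
∑∑-+ f g = trans (sum-cong λ x → sum-+ (f x) (g x)) (sum-+ _ _)

∑∑-*ˡ : ∀ c (f : Fin k → Fin n → ℕ) → ∑∑ (λ x y → c * f x y) ≡ c * ∑∑ f
∑∑-*ˡ c f = trans (sum-cong λ x → sum-*ˡ c (f x)) (sum-*ˡ c _)

∑∑-product : (f : Fin k → ℕ) (g : Fin n → ℕ) → ∑∑ (λ x y → f x * g y) ≡ sum f * sum g
∑∑-product f g = trans (sum-cong λ x → sum-*ˡ (f x) g) (sum-*ʳ (sum g) f)

sum-indicator : ∀ (v : Fin n) (f : Fin n → ℕ) → sum (λ x → 𝟙 ⌊ v F.≟ x ⌋ * f x) ≡ f v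
sum-indicator {suc n} zero f = begin
  sum (λ x → 𝟙 ⌊ zero F.≟ x ⌋ * f x)                        ≡⟨ sum-∷ _ ⟩
  f zero + 0 + sum (λ x → 𝟙 ⌊ zero F.≟ suc x ⌋ * f (suc x)) ≡⟨ cong₂ _+_ (+-identityʳ _) (sum-zero λ _ → refl) ⟩
  f zero + 0                                               ≡⟨ +-identityʳ _ ⟩
  f zero                                                   ∎
  where open ≡-Reasoning
sum-indicator {suc n} (suc v) f =
  trans (sum-∷ _) (trans (sum-cong λ x → cong (λ b → 𝟙 b * f (suc x)) (suc-≟ x)) (sum-indicator v (f ∘ suc)))
  where
  suc-≟ : ∀ x → ⌊ suc v F.≟ suc x ⌋ ≡ ⌊ v F.≟ x ⌋
  suc-≟ x with v F.≟ x
  ... | yes _ = refl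
  ... | no  _ = refl

-- Vertex sets, their sizes and edge counts

VSet : ℕ → Set
VSet n = Fin n → Bool

infixl 7 _∩_ _∖_
infix  4 _⊑_

_∩_ _∖_ : VSet n → VSet n → VSet n
(X ∩ Y) x = X x ∧ Y x
(X ∖ Y) x = X x ∧ not (Y x)

_⊑_ : VSet n → VSet n → Set
X ⊑ Y = ∀ x → X x ≡ true → Y x ≡ true

∩⊑ˡ : (X Y : VSet n) → X ∩ Y ⊑ X
∩⊑ˡ X Y x h = ∧-elimˡ h

∖⊑ : (X Y : VSet n) → X ∖ Y ⊑ X
∖⊑ X Y x h = ∧-elimˡ h

size : VSet n → ℕ
size X = sum (𝟙 ∘ X)

size-mono : {X Y : VSet n} → X ⊑ Y → size X ≤ size Y
size-mono h = sum-mono λ x → 𝟙-mono (h x)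

size-cong : {X Y : VSet n} → X ≗ Y → size X ≡ size Y
size-cong h = sum-cong (cong 𝟙 ∘ h)

size-full : ∀ n → size {n} (λ _ → true) ≡ n
size-full n = trans (sum-const n 1) (*-identityʳ n)

size-empty : ∀ n → size {n} (λ _ → false) ≡ 0
size-empty n = sum-zero λ _ → refl

size-split : (X Y : VSet n) → size X ≡ size (X ∩ Y) + size (X ∖ Y)
size-split X Y = trans (sum-cong λ x → lem (X x) (Y x)) (sum-+ _ _)
  where
  lem : ∀ a b → 𝟙 a ≡ 𝟙 (a ∧ b) + 𝟙 (a ∧ not b)
  lem true  true  = refl
  lem true  false = refl
  lem false _     = refl

size-∖ : {X W : VSet n} → W ⊑ X → size X ≡ size W + size (X ∖ W)
size-∖ {X = X} {W} h = trans (size-split X W) (cong (_+ size (X ∖ W)) (size-cong eq))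
  where
  eq : X ∩ W ≗ W
  eq x with W x in w
  ... | true  rewrite h x w = refl
  ... | false with X x
  ...   | true  = refl
  ...   | false = refl

size-singleton : (v : Fin n) → size (λ x → ⌊ v F.≟ x ⌋) ≡ 1
size-singleton v = trans (sum-cong λ x → sym (*-identityʳ (𝟙 ⌊ v F.≟ x ⌋))) (sum-indicator v (λ _ → 1))

opaque
  unfolding sum

  subset-of-size : (U : VSet n) → ∀ s → s ≤ size U → ∃ λ W → W ⊑ U × size W ≡ s
  subset-of-size {n} U zero _ = (λ _ → false) , (λ _ ()) , size-empty n
  subset-of-size {suc n} U (suc s) h with U zero in u
  ... | false with W , W⊑U , eq ← subset-of-size (U ∘ suc) (suc s) h = W′ , W′⊑ , eq
    where
    W′ : VSet (suc n)
    W′ zero    = false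
    W′ (suc x) = W x
    W′⊑ : W′ ⊑ U
    W′⊑ (suc x) w = W⊑U x w
  ... | true with W , W⊑U , eq ← subset-of-size (U ∘ suc) s (≤-pred h) = W′ , W′⊑ , cong suc eq
    where
    W′ : VSet (suc n)
    W′ zero    = true
    W′ (suc x) = W x
    W′⊑ : W′ ⊑ U
    W′⊑ zero    _ = u
    W′⊑ (suc x) w = W⊑U x w

-- Averaging: if `size U * g v` were below the sum for every `v` in `U`, adding these strict
-- inequalities over `U` would give `size U * S + size U ≤ size U * S`.
weighted-max : (U : VSet n) (g : Fin n → ℕ) → 1 ≤ size U →
  ∃ λ v → U v ≡ true × sum (λ x → 𝟙 (U x) * g x) ≤ size U * g v
weighted-max U g 1≤U with FP.any? (λ v → (U v Bool.≟ true) ×-dec (S ≤? size U * g v))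
  where
  S = sum (λ x → 𝟙 (U x) * g x)
... | yes (v , p) = v , p
... | no none = contradiction (begin-strict
    size U * S              <⟨ m<m+n _ 1≤U ⟩
    size U * S + size U     ≡⟨ cong (_+ size U) (sym (sum-*ˡ (size U) _)) ⟩
    sum (λ x → size U * (𝟙 (U x) * g x)) + size U ≡⟨ sum-+ _ (𝟙 ∘ U) ⟨
    sum (λ x → size U * (𝟙 (U x) * g x) + 𝟙 (U x)) ≤⟨ sum-mono pointwise ⟩
    sum (λ x → 𝟙 (U x) * S) ≡⟨ sum-*ʳ S (𝟙 ∘ U) ⟩
    size U * S              ∎) (<-irrefl refl)
  where
  open ≤-Reasoning
  S = sum (λ x → 𝟙 (U x) * g x)
  pointwise : ∀ x → size U * (𝟙 (U x) * g x) + 𝟙 (U x) ≤ 𝟙 (U x) * S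
  pointwise x with U x in u
  ... | false = ≤-reflexive (trans (+-identityʳ _) (*-zeroʳ (size U)))
  ... | true  = begin
    size U * (g x + 0) + 1 ≡⟨ cong (λ z → size U * z + 1) (+-identityʳ (g x)) ⟩
    size U * g x + 1       ≡⟨ +-comm _ 1 ⟩
    suc (size U * g x)     ≤⟨ ≰⇒> (λ le → none (x , u , le)) ⟩
    S                      ≡⟨ +-identityʳ S ⟨
    S + 0                  ∎

-- Ordered pairs are counted, so in a graph `e[ adj G ] X X` is twice the number of edges inside
-- `X`.
e[_] : (Fin n → Fin n → Bool) → VSet n → VSet n → ℕ
e[ f ] X Y = ∑∑ λ x y → 𝟙 (X x ∧ Y y ∧ f x y)

e-mono : ∀ (f : Fin n → Fin n → Bool) {X X′ Y Y′} → X ⊑ X′ → Y ⊑ Y′ → e[ f ] X Y ≤ e[ f ] X′ Y′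
e-mono f hX hY = ∑∑-mono λ x y → 𝟙-mono λ t →
  lem (hX x) (hY y) t
  where
  lem : ∀ {a a′ b b′ c} → (a ≡ true → a′ ≡ true) → (b ≡ true → b′ ≡ true) → a ∧ b ∧ c ≡ true → a′ ∧ b′ ∧ c ≡ true
  lem {true} {_} {true} p q refl rewrite p refl | q refl = refl

e≤size*size : ∀ (f : Fin n → Fin n → Bool) X Y → e[ f ] X Y ≤ size X * size Y
e≤size*size f X Y = ≤-trans (∑∑-mono λ x y → lem (X x) (Y y) (f x y)) (≤-reflexive (∑∑-product (𝟙 ∘ X) (𝟙 ∘ Y)))
  where
  lem : ∀ a b c → 𝟙 (a ∧ b ∧ c) ≤ 𝟙 a * 𝟙 b
  lem true  true  c = 𝟙≤1 c
  lem true  false c = z≤n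
  lem false b     c = z≤n

-- Sparse sets in graphs with few cliques

e-degrees : ∀ (f : Fin n → Fin n → Bool) X Y → e[ f ] X Y ≡ sum λ x → 𝟙 (X x) * size (Y ∩ f x)
e-degrees f X Y = sum-cong λ x →
  trans (sum-cong λ y → 𝟙-∧ (X x) (Y y ∧ f x y)) (sum-*ˡ (𝟙 (X x)) _)

without : VSet n → Fin n → VSet n
without U v = U ∖ λ x → ⌊ v F.≟ x ⌋

size-without : (U : VSet n) → ∀ v → U v ≡ true → size U ≡ suc (size (without U v))
size-without U v Uv = trans (size-∖ in-U) (cong (_+ size (without U v)) (size-singleton v))
  where
  in-U : (λ x → ⌊ v F.≟ x ⌋) ⊑ U
  in-U x t = subst (λ z → U z ≡ true) (⌊⌋-true {d = v F.≟ x} t) Uv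

-- The lost pairs form the row `R` and the column `C` of `v`. They meet only in `(v , v)`, which is
-- not an edge, so nothing is counted twice.
e-without : (G : Graph n) (U : VSet n) → ∀ v → U v ≡ true →
  e[ adj G ] (without U v) (without U v) + (size (U ∩ adj G v) + size (U ∩ adj G v)) ≤ e[ adj G ] U U
e-without {n} G U v Uv = begin
  e[ f ] U′ U′ + (d + d)
    ≡⟨ cong₂ (λ a b → e[ f ] U′ U′ + (a + b)) (sym row) (sym col) ⟩
  e[ f ] U′ U′ + (∑∑ R + ∑∑ C)
    ≡⟨ cong (e[ f ] U′ U′ +_) (∑∑-+ R C) ⟨
  e[ f ] U′ U′ + ∑∑ (λ x y → R x y + C x y)
    ≡⟨ ∑∑-+ _ (λ x y → R x y + C x y) ⟨
  ∑∑ (λ x y → 𝟙 (U′ x ∧ U′ y ∧ f x y) + (R x y + C x y))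
    ≤⟨ ∑∑-mono pointwise ⟩
  e[ f ] U U ∎
  where
  open ≤-Reasoning
  f = adj G
  U′ = without U v
  d = size (U ∩ f v)
  R C : Fin n → Fin n → ℕ
  R x y = 𝟙 ⌊ v F.≟ x ⌋ * 𝟙 (U y ∧ f v y)
  C x y = 𝟙 (U x ∧ f v x) * 𝟙 ⌊ v F.≟ y ⌋
  row : ∑∑ R ≡ d
  row = trans (∑∑-product (λ x → 𝟙 ⌊ v F.≟ x ⌋) _) (trans (cong (_* d) (size-singleton v)) (*-identityˡ d))
  col : ∑∑ C ≡ d
  col = trans (∑∑-product _ (λ y → 𝟙 ⌊ v F.≟ y ⌋)) (trans (cong (d *_) (size-singleton v)) (*-identityʳ d))
  pointwise : ∀ x y → 𝟙 (U′ x ∧ U′ y ∧ f x y) + (R x y + C x y) ≤ 𝟙 (U x ∧ U y ∧ f x y)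
  pointwise x y with v F.≟ x | v F.≟ y
  ... | yes refl | yes refl rewrite irrefl G v | Uv = ≤-refl
  ... | yes refl | no _ rewrite Uv = ≤-reflexive (lem (U y ∧ f v y) (f v v))
    where
    lem : ∀ a b → (𝟙 a + 0) + 𝟙 b * 0 ≡ 𝟙 a
    lem a b rewrite *-zeroʳ (𝟙 b) | +-identityʳ (𝟙 a + 0) = +-identityʳ (𝟙 a)
  ... | no _ | yes refl rewrite Uv | Graph.sym G x v = ≤-reflexive (lem (U x) (f v x))
    where
    lem : ∀ a b → 𝟙 ((a ∧ true) ∧ false) + 𝟙 (a ∧ b) * 1 ≡ 𝟙 (a ∧ b)
    lem true  b = *-identityʳ (𝟙 b)
    lem false b = refl
  ... | no _ | no _ = ≤-reflexive (lem (U x) (U y) (f x y) (f v x))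
    where
    lem : ∀ a b c d → 𝟙 ((a ∧ true) ∧ (b ∧ true) ∧ c) + 𝟙 (a ∧ d) * 0 ≡ 𝟙 (a ∧ b ∧ c)
    lem true  true  c d rewrite *-zeroʳ (𝟙 d) = +-identityʳ (𝟙 c)
    lem true  false c d = *-zeroʳ (𝟙 d)
    lem false b     c d = refl

-- Deleting a vertex of maximum degree does not increase e(U,U) / |U|².
shrink : (G : Graph n) → ∀ d U s → 1 ≤ s → size U ≡ s + d →
  ∃ λ W → W ⊑ U × size W ≡ s × e[ adj G ] W W * (size U * size U) ≤ e[ adj G ] U U * (s * s)
shrink G zero U s 1≤s eq = U , (λ _ t → t) , U≡s , ≤-reflexive (cong (λ z → e[ adj G ] U U * (z * z)) U≡s)
  where
  U≡s : size U ≡ s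
  U≡s = trans eq (+-identityʳ s)
shrink {n} G (suc d) U s 1≤s eq
  with v , Uv , big ← weighted-max U (λ x → size (U ∩ adj G x)) (subst (1 ≤_) (sym eq) (≤-trans 1≤s (m≤m+n s (suc d))))
  with W , W⊑U′ , W≡s , ih ← shrink G d (without U v) s 1≤s
         (suc-injective (trans (sym (size-without U v Uv)) (trans eq (+-suc s d))))
  = W , (λ x t → ∧-elimˡ (W⊑U′ x t)) , W≡s ,
    *-cancelʳ-≤ _ _ (w * w) {{m*n≢0 w w {{w≢0}} {{w≢0}}}} (begin
      eW * (size U * size U) * (w * w) ≡⟨ cong (λ z → eW * (z * z) * (w * w)) U≡ ⟩
      eW * (u * u) * (w * w)  ≡⟨ swap₁ eW (u * u) (w * w) ⟩
      eW * (w * w) * (u * u)  ≤⟨ *-monoˡ-≤ (u * u) ih ⟩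
      e′ * (s * s) * (u * u)  ≡⟨ swap₁ e′ (s * s) (u * u) ⟩
      e′ * (u * u) * (s * s)  ≤⟨ *-monoˡ-≤ (s * s) step ⟩
      eU * (w * w) * (s * s)  ≡⟨ swap₁ eU (w * w) (s * s) ⟩
      eU * (s * s) * (w * w)  ∎)
  where
  open ≤-Reasoning
  U′ = without U v
  eW = e[ adj G ] W W
  e′ = e[ adj G ] U′ U′
  eU = e[ adj G ] U U
  w = size U′
  u = suc w
  δ = size (U ∩ adj G v)
  U≡ : size U ≡ u
  U≡ = size-without U v Uv
  w≢0 : NonZero w
  w≢0 = >-nonZero (subst (1 ≤_) (sym (suc-injective (trans (sym U≡) (trans eq (+-suc s d))))) (≤-trans 1≤s (m≤m+n s d)))
  swap₁ : ∀ a b c → a * b * c ≡ a * c * b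
  swap₁ = solve-∀
  avg : eU ≤ u * δ
  avg = subst (λ z → eU ≤ z * δ) U≡ (≤-trans (≤-reflexive (e-degrees (adj G) U U)) big)
  -- From `e′ + 2 δ ≤ eU` and `eU ≤ u δ`: e′ u² ≤ eU u² - 2 δ u² ≤ eU (u² - 2u) ≤ eU (u - 1)².
  step : e′ * (u * u) ≤ eU * (w * w)
  step = +-cancelʳ-≤ (2 * (eU * u)) _ _ (begin
    e′ * (u * u) + 2 * (eU * u)          ≤⟨ +-monoʳ-≤ (e′ * (u * u)) (*-monoʳ-≤ 2 (*-monoˡ-≤ u avg)) ⟩
    e′ * (u * u) + 2 * (u * δ * u)       ≡⟨ rearr e′ δ u ⟩
    (e′ + (δ + δ)) * (u * u)             ≤⟨ *-monoˡ-≤ (u * u) (e-without G U v Uv) ⟩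
    eU * (u * u)                         ≤⟨ m≤m+n _ eU ⟩
    eU * (u * u) + eU                    ≡⟨ expand eU w ⟩
    eU * (w * w) + 2 * (eU * u)          ∎)
    where
    rearr : ∀ a d u → a * (u * u) + 2 * (u * d * u) ≡ (a + (d + d)) * (u * u)
    rearr = solve-∀
    expand : ∀ e w → e * (suc w * suc w) + e ≡ e * (w * w) + 2 * (e * suc w)
    expand = solve-∀

-- Cliques are counted with an ordering of their vertices: r! times as often as by k[_].
cliques : Graph n → ℕ → VSet n → ℕ
cliques G zero    U = 1
cliques G (suc r) U = sum λ v → 𝟙 (U v) * cliques G r (U ∩ adj G v)

SparseIn : Graph n → ℕ → VSet n → ℕ → Set
SparseIn G N U s = ∃ λ W → W ⊑ U × size W ≡ s × N * e[ adj G ] W W ≤ s * s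

-- The degree bound gives `e(U,U) ≤ |U| M s ≤ |U|² / N`, and `shrink` carries this density down to a
-- subset of size `s`.
sparse-of-bounded-degree : (G : Graph n) → ∀ N M U s → 1 ≤ s → 1 ≤ M → s ≤ size U → N * (M * s) ≤ size U →
  (∀ v → U v ≡ true → size (U ∩ adj G v) ≤ M * s) → SparseIn G N U s
sparse-of-bounded-degree G N M U s 1≤s 1≤M s≤U NMs≤U deg
  with W , W⊑U , W≡s , ratio ← shrink G (size U ∸ s) U s 1≤s (sym (m+[n∸m]≡n s≤U))
  = W , W⊑U , W≡s ,
    *-cancelʳ-≤ _ _ (M * s) {{m*n≢0 M s {{>-nonZero 1≤M}} {{>-nonZero 1≤s}}}}
      (*-cancelʳ-≤ _ _ u {{>-nonZero (≤-trans 1≤s s≤U)}} (begin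
        N * eW * (M * s) * u    ≡⟨ r₁ N eW (M * s) u ⟩
        eW * (N * (M * s) * u)  ≤⟨ *-monoʳ-≤ eW (*-monoˡ-≤ u NMs≤U) ⟩
        eW * (u * u)            ≤⟨ ratio ⟩
        eU * (s * s)            ≤⟨ *-monoˡ-≤ (s * s) eU≤ ⟩
        u * (M * s) * (s * s)   ≡⟨ r₂ u (M * s) (s * s) ⟩
        s * s * (M * s) * u     ∎))
  where
  open ≤-Reasoning
  u = size U
  eW = e[ adj G ] W W
  eU = e[ adj G ] U U
  r₁ : ∀ a b c d → a * b * c * d ≡ b * (a * c * d)
  r₁ = solve-∀
  r₂ : ∀ a b c → a * b * c ≡ c * b * a
  r₂ = solve-∀
  eU≤ : eU ≤ u * (M * s)
  eU≤ = begin
    eU                                          ≡⟨ e-degrees (adj G) U U ⟩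
    sum (λ v → 𝟙 (U v) * size (U ∩ adj G v))    ≤⟨ sum-mono pointwise ⟩
    sum (λ v → 𝟙 (U v) * (M * s))               ≡⟨ sum-*ʳ (M * s) (𝟙 ∘ U) ⟩
    u * (M * s)                                 ∎
    where
    pointwise : ∀ v → 𝟙 (U v) * size (U ∩ adj G v) ≤ 𝟙 (U v) * (M * s)
    pointwise v with U v in t
    ... | false = z≤n
    ... | true  = *-monoʳ-≤ 1 (deg v t)

-- Of the `N * M + 2` multiples of `s`, one pays for the set `H` deleted in `sparse-set`, one
-- guarantees room for `s` vertices in the remainder, and `N * M` are what
-- `sparse-of-bounded-degree` requires there.
sparseM : ℕ → ℕ → ℕ
sparseM N zero    = 1
sparseM N (suc r) = N * sparseM N r + 2

sparseM≥1 : ∀ N r → 1 ≤ sparseM N r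
sparseM≥1 N zero    = ≤-refl
sparseM≥1 N (suc r) = ≤-trans (s≤s z≤n) (m≤n+m 2 (N * sparseM N r))

-- Either some neighbourhood is large and has few r-cliques, or few vertices have large degree.
sparse-set : (G : Graph n) → ∀ N r U s → 1 ≤ s → sparseM N r * s ≤ size U →
  2 * cliques G r U ≤ s ^ r → SparseIn G N U s
-- The factor 2 in the clique condition is there for this case: it reads `2 ≤ 1`, so the passage to
-- neighbourhoods must have stopped earlier.
sparse-set G N zero U s 1≤s _ few = contradiction few (<⇒≱ ≤-refl)
sparse-set {n} G N (suc r) U s 1≤s large few
  with FP.any? (λ v → (U v Bool.≟ true) ×-dec (sparseM N r * s ≤? size (U ∩ adj G v)) ×-dec (2 * cliques G r (U ∩ adj G v) ≤? s ^ r))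
... | yes (v , Uv , big , few′) with W , W⊑ , rest ← sparse-set G N r (U ∩ adj G v) s 1≤s big few′
  = W , (λ x t → ∧-elimˡ (W⊑ x t)) , rest
... | no none = let W , W⊑ , rest = sparse-of-bounded-degree G N M U′ s 1≤s (sparseM≥1 N r) s≤U′ NMs≤U′ deg
  in W , (λ x t → ∖⊑ U H x (W⊑ x t)) , rest
  where
  open ≤-Reasoning
  M = sparseM N r
  H : VSet n
  H v = U v ∧ ⌊ M * s ≤? size (U ∩ adj G v) ⌋
  U′ = U ∖ H
  H⊑U : H ⊑ U
  H⊑U v t = ∧-elimˡ t
  pointwise : ∀ v → 𝟙 (H v) * suc (s ^ r) ≤ 2 * (𝟙 (U v) * cliques G r (U ∩ adj G v))
  pointwise v with U v in u | M * s ≤? size (U ∩ adj G v)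
  ... | false | _      = z≤n
  ... | true  | no _   = z≤n
  ... | true  | yes le rewrite +-identityʳ (cliques G r (U ∩ adj G v)) | +-identityʳ (s ^ r) =
        ≰⇒> λ few′ → none (v , u , le , few′)
  -- By `none`, the neighbourhood of each vertex of `H` has more than `s ^ r / 2` ordered r-cliques;
  -- with more than `s` such vertices, `U` would contain too many ordered cliques with one vertex
  -- more.
  H≤s : size H ≤ s
  H≤s = ≮⇒≥ λ s<H → <⇒≱ (begin-strict
    s * s ^ r                     <⟨ *-mono-< s<H (n<1+n (s ^ r)) ⟩
    size H * suc (s ^ r)          ∎) (begin
    size H * suc (s ^ r)          ≡⟨ sum-*ʳ (suc (s ^ r)) (𝟙 ∘ H) ⟨
    sum (λ v → 𝟙 (H v) * suc (s ^ r)) ≤⟨ sum-mono pointwise ⟩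
    sum (λ v → 2 * (𝟙 (U v) * cliques G r (U ∩ adj G v))) ≡⟨ sum-*ˡ 2 _ ⟩
    2 * cliques G (suc r) U       ≤⟨ few ⟩
    s * s ^ r                     ∎)
  U′≥ : N * (M * s) + s ≤ size U′
  U′≥ = +-cancelˡ-≤ s _ _ (begin
    s + (N * (M * s) + s)   ≡⟨ r₁ N M s ⟩
    (N * M + 2) * s         ≤⟨ large ⟩
    size U                  ≡⟨ size-∖ H⊑U ⟩
    size H + size U′        ≤⟨ +-monoˡ-≤ (size U′) H≤s ⟩
    s + size U′             ∎)
    where
    r₁ : ∀ N M s → s + (N * (M * s) + s) ≡ (N * M + 2) * s
    r₁ = solve-∀
  s≤U′ : s ≤ size U′
  s≤U′ = ≤-trans (m≤n+m s _) U′≥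
  NMs≤U′ : N * (M * s) ≤ size U′
  NMs≤U′ = ≤-trans (m≤m+n _ s) U′≥
  deg : ∀ v → U′ v ≡ true → size (U′ ∩ adj G v) ≤ M * s
  deg v t with M * s ≤? size (U ∩ adj G v)
  ... | no ≰ = ≤-trans (size-mono λ x p → ∧-intro (∖⊑ U H x (∧-elimˡ p)) (∧-elimʳ p)) (<⇒≤ (≰⇒> ≰))
  ... | yes _ = contradiction t (lem (U v))
    where
    lem : ∀ a → ¬ (a ∧ not (a ∧ true) ≡ true)
    lem true  ()
    lem false ()

-- Counting cliques

countᵇ-∷ : (p : Elt → Bool) → ∀ x xs → countᵇ p (x ∷ xs) ≡ 𝟙 (p x) + countᵇ p xs
countᵇ-∷ p x xs with p x
... | true  = refl
... | false = refl

countᵇ-++ : (p : Elt → Bool) → ∀ xs ys → countᵇ p (xs ++ ys) ≡ countᵇ p xs + countᵇ p ys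
countᵇ-++ p []       ys = refl
countᵇ-++ p (x ∷ xs) ys = begin
  countᵇ p (x ∷ xs ++ ys)                    ≡⟨ countᵇ-∷ p x (xs ++ ys) ⟩
  𝟙 (p x) + countᵇ p (xs ++ ys)              ≡⟨ cong (𝟙 (p x) +_) (countᵇ-++ p xs ys) ⟩
  𝟙 (p x) + (countᵇ p xs + countᵇ p ys)      ≡⟨ +-assoc (𝟙 (p x)) _ _ ⟨
  𝟙 (p x) + countᵇ p xs + countᵇ p ys        ≡⟨ cong (_+ countᵇ p ys) (countᵇ-∷ p x xs) ⟨
  countᵇ p (x ∷ xs) + countᵇ p ys            ∎
  where open ≡-Reasoning

countᵇ-map : (p : Elt′ → Bool) (f : Elt → Elt′) → ∀ xs → countᵇ p (List.map f xs) ≡ countᵇ (p ∘ f) xs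
countᵇ-map p f []       = refl
countᵇ-map p f (x ∷ xs) =
  trans (countᵇ-∷ p (f x) (List.map f xs)) (trans (cong (𝟙 (p (f x)) +_) (countᵇ-map p f xs)) (sym (countᵇ-∷ (p ∘ f) x xs)))

countᵇ-none : {p : Elt → Bool} → (∀ x → p x ≡ false) → ∀ xs → countᵇ p xs ≡ 0
countᵇ-none         h []       = refl
countᵇ-none {p = p} h (x ∷ xs) = trans (countᵇ-∷ p x xs) (cong₂ _+_ (cong 𝟙 (h x)) (countᵇ-none h xs))

countᵇ-tabulate : (p : Elt → Bool) (g : Fin n → Elt) → countᵇ p (List.tabulate g) ≡ sum (𝟙 ∘ p ∘ g)
countᵇ-tabulate {n = zero}  p g = sym (sum-[] _)
countᵇ-tabulate {n = suc n} p g =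
  trans (countᵇ-∷ p (g zero) _) (trans (cong (𝟙 (p (g zero)) +_) (countᵇ-tabulate p (g ∘ suc))) (sym (sum-∷ _)))

countᵇ-concatMap : (p : Elt′ → Bool) (h : Elt → List Elt′) (g : Fin n → Elt) →
  countᵇ p (concatMap h (List.tabulate g)) ≡ sum λ i → countᵇ p (h (g i))
countᵇ-concatMap {n = zero}  p h g = sym (sum-[] _)
countᵇ-concatMap {n = suc n} p h g =
  trans (countᵇ-++ p (h (g zero)) _) (trans (cong (countᵇ p (h (g zero)) +_) (countᵇ-concatMap p h (g ∘ suc))) (sym (sum-∷ _)))

countᵇ-allPairs : ∀ n (p : Fin n × Fin n → Bool) → countᵇ p (allPairs n) ≡ ∑∑ λ x y → 𝟙 (p (x , y))
countᵇ-allPairs n p = trans (countᵇ-concatMap p _ id)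
  (sum-cong λ x → trans (countᵇ-map p (x ,_) (allFin n)) (countᵇ-tabulate (p ∘ (x ,_)) id))

∑ₛ : (Subset n → ℕ) → ℕ
∑ₛ {zero}  g = g []
∑ₛ {suc n} g = ∑ₛ (g ∘ (inside ∷_)) + ∑ₛ (g ∘ (outside ∷_))

countᵇ-allSubsets : ∀ n (p : Subset n → Bool) → countᵇ p (allSubsets n) ≡ ∑ₛ (𝟙 ∘ p)
countᵇ-allSubsets zero    p = trans (countᵇ-∷ p [] []) (+-identityʳ _)
countᵇ-allSubsets (suc n) p = trans (countᵇ-++ p (List.map (inside ∷_) (allSubsets n)) _) (cong₂ _+_
  (trans (countᵇ-map p (inside  ∷_) (allSubsets n)) (countᵇ-allSubsets n _))
  (trans (countᵇ-map p (outside ∷_) (allSubsets n)) (countᵇ-allSubsets n _)))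

∑ₛ-mono : {g h : Subset n → ℕ} → (∀ S → g S ≤ h S) → ∑ₛ g ≤ ∑ₛ h
∑ₛ-mono {zero}  le = le []
∑ₛ-mono {suc n} le = +-mono-≤ (∑ₛ-mono (le ∘ (inside ∷_))) (∑ₛ-mono (le ∘ (outside ∷_)))

∑ₛ-cong : {g h : Subset n → ℕ} → (∀ S → g S ≡ h S) → ∑ₛ g ≡ ∑ₛ h
∑ₛ-cong {zero}  eq = eq []
∑ₛ-cong {suc n} eq = cong₂ _+_ (∑ₛ-cong (eq ∘ (inside ∷_))) (∑ₛ-cong (eq ∘ (outside ∷_)))

∑ₛ-*ˡ : ∀ c (g : Subset n → ℕ) → ∑ₛ (λ S → c * g S) ≡ c * ∑ₛ g
∑ₛ-*ˡ {zero}  c g = refl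
∑ₛ-*ˡ {suc n} c g = trans (cong₂ _+_ (∑ₛ-*ˡ c (g ∘ (inside ∷_))) (∑ₛ-*ˡ c (g ∘ (outside ∷_)))) (sym (*-distribˡ-+ c _ _))

∑ₛ-zero : ∀ n → ∑ₛ {n} (λ _ → 0) ≡ 0
∑ₛ-zero zero    = refl
∑ₛ-zero (suc n) = cong₂ _+_ (∑ₛ-zero n) (∑ₛ-zero n)

∑ₛ-swap : ∀ {m} (g : Fin m → Subset n → ℕ) → sum (λ v → ∑ₛ (g v)) ≡ ∑ₛ λ S → sum λ v → g v S
∑ₛ-swap {zero}  g = refl
∑ₛ-swap {suc n} g = trans (sum-+ _ _)
  (cong₂ _+_ (∑ₛ-swap λ v S → g v (inside ∷ S)) (∑ₛ-swap λ v S → g v (outside ∷ S)))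

term≤∑ₛ : (g : Subset n → ℕ) → ∀ S → g S ≤ ∑ₛ g
term≤∑ₛ g []            = ≤-refl
term≤∑ₛ g (inside  ∷ S) = ≤-trans (term≤∑ₛ (g ∘ (inside  ∷_)) S) (m≤m+n _ _)
term≤∑ₛ g (outside ∷ S) = ≤-trans (term≤∑ₛ (g ∘ (outside ∷_)) S) (m≤n+m _ _)

-- Reindexing along the bijection that adds `v`, from the subsets avoiding `v` to those containing
-- it.
∑ₛ-insert : ∀ (v : Fin n) (h : Subset n → ℕ) →
  ∑ₛ (λ S → 𝟙 (not (lookup S v)) * h (S [ v ]≔ inside)) ≡ ∑ₛ (λ S → 𝟙 (lookup S v) * h S)
∑ₛ-insert {suc n} zero    h rewrite ∑ₛ-zero n = sym (+-identityʳ _)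
∑ₛ-insert {suc n} (suc v) h = cong₂ _+_ (∑ₛ-insert v (h ∘ (inside ∷_))) (∑ₛ-insert v (h ∘ (outside ∷_)))

card≡size : (S : Subset n) → card S ≡ size (lookup S)
card≡size []            = sym (sum-[] _)
card≡size (inside  ∷ S) = trans (cong suc (card≡size S)) (sym (sum-∷ _))
card≡size (outside ∷ S) = trans (card≡size S) (sym (sum-∷ _))

card-insert : (S : Subset n) → ∀ v → lookup S v ≡ false → card (S [ v ]≔ inside) ≡ suc (card S)
card-insert (outside ∷ S) zero    _ = refl
card-insert (inside  ∷ S) (suc v) h = cong suc (card-insert S v h)
card-insert (outside ∷ S) (suc v) h = card-insert S v h

module _ (G : Graph n) where

  CliqueIn : ℕ → VSet n → Subset n → Set
  CliqueIn r U S = card S ≡ r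
    × (∀ x y → lookup S x ≡ true → lookup S y ≡ true → x ≢ y → adj G x y ≡ true)
    × (∀ x → lookup S x ≡ true → U x ≡ true)

  cliqueIn? : ∀ r U S → Dec (CliqueIn r U S)
  cliqueIn? r U S = (card S ≟ r)
    ×-dec FP.all? (λ x → FP.all? λ y → (lookup S x Bool.≟ true) →-dec (lookup S y Bool.≟ true)
            →-dec ¬? (x F.≟ y) →-dec (adj G x y Bool.≟ true))
    ×-dec FP.all? (λ x → (lookup S x Bool.≟ true) →-dec (U x Bool.≟ true))

  cliqueIn-insert : ∀ r U v S → U v ≡ true → CliqueIn r (U ∩ adj G v) S →
    lookup S v ≡ false × CliqueIn (suc r) U (S [ v ]≔ inside)
  cliqueIn-insert r U v S Uv (card≡ , clique , S⊑) = v∉S , trans (card-insert S v v∉S) (cong suc card≡) , clique′ , S′⊑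
    where
    v∉S : lookup S v ≡ false
    v∉S with lookup S v in eq
    ... | false = refl
    ... | true  = trans (sym (∧-elimʳ {U v} (S⊑ v eq))) (irrefl G v)
    old : ∀ x → x ≢ v → lookup (S [ v ]≔ inside) x ≡ true → lookup S x ≡ true
    old x x≢v t = trans (sym (lookup∘update′ x≢v S inside)) t
    clique′ : ∀ x y → lookup (S [ v ]≔ inside) x ≡ true → lookup (S [ v ]≔ inside) y ≡ true → x ≢ y → adj G x y ≡ true
    clique′ x y tx ty x≢y with x F.≟ v | y F.≟ v
    ... | yes refl | yes refl = contradiction refl x≢y
    ... | yes refl | no y≢v   = ∧-elimʳ {U y} (S⊑ y (old y y≢v ty))
    ... | no x≢v   | yes refl = trans (Graph.sym G x y) (∧-elimʳ {U x} (S⊑ x (old x x≢v tx)))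
    ... | no x≢v   | no y≢v   = clique x y (old x x≢v tx) (old y y≢v ty) x≢y
    S′⊑ : ∀ x → lookup (S [ v ]≔ inside) x ≡ true → U x ≡ true
    S′⊑ x t with x F.≟ v
    ... | yes refl = Uv
    ... | no x≢v   = ∧-elimˡ (S⊑ x (old x x≢v t))

  -- Double counting: an r-clique `S` in the neighbourhood of `v` becomes an (r+1)-clique with the
  -- marked vertex `v`, and each (r+1)-clique can be marked in `suc r` ways.
  cliques≤∑ₛ : ∀ r U → cliques G r U ≤ r ! * ∑ₛ (λ S → 𝟙 ⌊ cliqueIn? r U S ⌋)
  cliques≤∑ₛ zero U = begin
    1                                        ≡⟨ cong 𝟙 (true-⌊⌋ {d = cliqueIn? 0 U ∅} empty) ⟨
    𝟙 ⌊ cliqueIn? 0 U ∅ ⌋                    ≤⟨ term≤∑ₛ (λ S → 𝟙 ⌊ cliqueIn? 0 U S ⌋) ∅ ⟩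
    ∑ₛ (λ S → 𝟙 ⌊ cliqueIn? 0 U S ⌋)         ≡⟨ +-identityʳ _ ⟨
    1 * ∑ₛ (λ S → 𝟙 ⌊ cliqueIn? 0 U S ⌋)     ∎
    where
    open ≤-Reasoning
    ∉∅ : ∀ x → ¬ lookup ∅ x ≡ true
    ∉∅ x t with () ← trans (sym t) (lookup-replicate x outside)
    empty : CliqueIn 0 U ∅
    empty = ∣⊥∣≡0 n , (λ x _ t → contradiction t (∉∅ x)) , (λ x t → contradiction t (∉∅ x))
  cliques≤∑ₛ (suc r) U = begin
    sum (λ v → 𝟙 (U v) * cliques G r (U ∩ adj G v))
      ≤⟨ sum-mono (λ v → *-monoʳ-≤ (𝟙 (U v)) (cliques≤∑ₛ r (U ∩ adj G v))) ⟩
    sum (λ v → 𝟙 (U v) * (r ! * ∑ₛ (φ v)))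
      ≡⟨ sum-cong (λ v → trans (r₁ (𝟙 (U v)) (r !) (∑ₛ (φ v))) (cong (r ! *_) (sym (∑ₛ-*ˡ (𝟙 (U v)) (φ v))))) ⟩
    sum (λ v → r ! * ∑ₛ (λ S → 𝟙 (U v) * φ v S))
      ≡⟨ sum-*ˡ (r !) _ ⟩
    r ! * sum (λ v → ∑ₛ (λ S → 𝟙 (U v) * φ v S))
      ≤⟨ *-monoʳ-≤ (r !) (sum-mono λ v → ∑ₛ-mono (pointwise v)) ⟩
    r ! * sum (λ v → ∑ₛ (λ S → 𝟙 (not (lookup S v)) * ψ (S [ v ]≔ inside)))
      ≡⟨ cong (r ! *_) (sum-cong λ v → ∑ₛ-insert v ψ) ⟩
    r ! * sum (λ v → ∑ₛ (λ S → 𝟙 (lookup S v) * ψ S))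
      ≡⟨ cong (r ! *_) (∑ₛ-swap λ v S → 𝟙 (lookup S v) * ψ S) ⟩
    r ! * ∑ₛ (λ S → sum (λ v → 𝟙 (lookup S v) * ψ S))
      ≡⟨ cong (r ! *_) (trans (∑ₛ-cong count) (∑ₛ-*ˡ (suc r) ψ)) ⟩
    r ! * (suc r * ∑ₛ ψ)
      ≡⟨ r₂ (r !) (suc r) (∑ₛ ψ) ⟩
    suc r * r ! * ∑ₛ ψ ∎
    where
    open ≤-Reasoning
    φ : Fin n → Subset n → ℕ
    φ v S = 𝟙 ⌊ cliqueIn? r (U ∩ adj G v) S ⌋
    ψ : Subset n → ℕ
    ψ S = 𝟙 ⌊ cliqueIn? (suc r) U S ⌋
    r₁ : ∀ a b c → a * (b * c) ≡ b * (a * c)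
    r₁ = solve-∀
    r₂ : ∀ a b c → a * (b * c) ≡ b * a * c
    r₂ = solve-∀
    pointwise : ∀ v S → 𝟙 (U v) * φ v S ≤ 𝟙 (not (lookup S v)) * ψ (S [ v ]≔ inside)
    pointwise v S with U v in Uv | cliqueIn? r (U ∩ adj G v) S
    ... | false | _     = z≤n
    ... | true  | no _  = z≤n
    ... | true  | yes c with v∉S , c′ ← cliqueIn-insert r U v S Uv c
        rewrite v∉S | true-⌊⌋ {d = cliqueIn? (suc r) U (S [ v ]≔ inside)} c′ = ≤-refl
    count : ∀ S → sum (λ v → 𝟙 (lookup S v) * ψ S) ≡ suc r * ψ S
    count S = trans (sum-*ʳ (ψ S) _) (trans (cong (_* ψ S) (sym (card≡size S))) lem)
      where
      lem : card S * ψ S ≡ suc r * ψ S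
      lem with cliqueIn? (suc r) U S
      ... | yes (card≡ , _) = cong (_* 1) card≡
      ... | no  _ = trans (*-zeroʳ (card S)) (sym (*-zeroʳ r))

  cliques≤k : ∀ r U → cliques G r U ≤ r ! * k[ r ] G
  cliques≤k r U = ≤-trans (cliques≤∑ₛ r U) (*-monoʳ-≤ (r !)
    (≤-trans (∑ₛ-mono λ S → 𝟙-mono λ t → clique⇒ᵇ S (⌊⌋-true {d = cliqueIn? r U S} t)) (≤-reflexive (sym (countᵇ-allSubsets n _)))))
    where
    ≡ᵇ-true : ∀ {a b} → a ≡ b → (a ≡ᵇ b) ≡ true
    ≡ᵇ-true {a} {b} eq = BP.T-≡ .Equivalence.to (≡⇒≡ᵇ a b eq)
    clique⇒ᵇ : ∀ S → CliqueIn r U S → (card S ≡ᵇ r) ∧ isCliqueᵇ G S ≡ true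
    clique⇒ᵇ S (card≡ , clique , _) = ∧-intro (≡ᵇ-true card≡) (≡ᵇ-true (countᵇ-none (λ (x , y) → none x y) (allPairs n)))
      where
      none : ∀ x y → lookup S x ∧ lookup S y ∧ not ⌊ x F.≟ y ⌋ ∧ not (adj G x y) ≡ false
      none x y with lookup S x in tx | lookup S y in ty | x F.≟ y
      ... | false | _     | _      = refl
      ... | true  | false | _      = refl
      ... | true  | true  | yes _  = refl
      ... | true  | true  | no x≢y rewrite clique x y tx ty x≢y = refl

-- Refining partitions

cls : (Fin n → Fin q) → Fin q → VSet n
cls p c x = ⌊ p x F.≟ c ⌋

cls-elim : (p : Fin n → Fin q) → ∀ {c x} → cls p c x ≡ true → p x ≡ c
cls-elim p {c} {x} = ⌊⌋-true {d = p x F.≟ c}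

cls-intro : (p : Fin n → Fin q) → ∀ {c x} → p x ≡ c → cls p c x ≡ true
cls-intro p {c} {x} = true-⌊⌋ {d = p x F.≟ c}

sum-classes : (p : Fin n → Fin q) (g : Fin n → ℕ) → sum (λ c → sum λ x → 𝟙 (cls p c x) * g x) ≡ sum g
sum-classes p g = trans (sum-swap _) (sum-cong λ x → sum-indicator (p x) (λ _ → g x))

-- Besides closure under subsets this supplies invariance under pointwise equality of Boolean
-- functions, which does not come for free; `Piece-resp` uses it in this way.
Hereditary : (VSet n → Set) → Set
Hereditary P = ∀ {W W′} → W′ ⊑ W → P W → P W′

size-antisym : {X Y : VSet n} → X ⊑ Y → Y ⊑ X → size X ≡ size Y
size-antisym X⊑Y Y⊑X = ≤-antisym (size-mono X⊑Y) (size-mono Y⊑X)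

-- Label 1 is given to the set just split off, and 0 stays the label of whatever has not been put
-- into a piece.
merge : Bool → Fin (suc κ) → Fin (suc (suc κ))
merge true  _       = suc zero
merge false zero    = zero
merge false (suc a) = suc (suc a)

merge-1 : ∀ b (a : Fin (suc κ)) → merge b a ≡ suc zero → b ≡ true
merge-1 true  _ _ = refl
merge-1 false zero ()
merge-1 false (suc _) ()

merge-≥2 : ∀ b (c : Fin (suc κ)) a → merge b c ≡ suc (suc a) → b ≡ false × c ≡ suc a
merge-≥2 false (suc a) .a refl = refl , refl

Piece : VSet n → ℕ → (VSet n → Set) → VSet n → Set
Piece R s P W = size W ≡ s × W ⊑ R × P W

Piece-resp : ∀ {R : VSet n} {s P} → Hereditary P → ∀ {W W′} → W′ ⊑ W → W ⊑ W′ → Piece R s P W → Piece R s P W′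
Piece-resp P-her into onto (eq , ⊑R , PW) = trans (size-antisym into onto) eq , (λ x t → ⊑R x (into x t)) , P-her into PW

merge-pieces : ∀ {R W : VSet n} {s P} → Hereditary P → Piece R s P W → (c : Fin n → Fin (suc κ)) →
  (∀ a → Piece (R ∖ W) s P (cls c (suc a))) → ∀ a → Piece R s P (cls (λ x → merge (W x) (c x)) (suc a))
merge-pieces {W = W} P-her PW c pieces zero = Piece-resp P-her
  (λ x t → merge-1 (W x) (c x) (cls-elim (λ x → merge (W x) (c x)) t))
  (λ x t → cls-intro (λ x → merge (W x) (c x)) (cong (λ b → merge b (c x)) t)) PW
merge-pieces {R = R} {W} P-her PW c pieces (suc a) with eq , c⊑ , Pc ← pieces a = Piece-resp P-her
  (λ x t → cls-intro c (proj₂ (merge-≥2 (W x) (c x) a (cls-elim (λ x → merge (W x) (c x)) t))))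
  (λ x t → cls-intro (λ x → merge (W x) (c x)) (cong₂ merge (not-true⇒false (∧-elimʳ {R x} (c⊑ x t))) (cls-elim c t)))
  (eq , (λ x t → ∧-elimˡ (c⊑ x t)) , Pc)

-- Greedy cutting: `find` works as long as `D` vertices remain, and before the last of the `h` cuts
-- only `h - 1` pieces are gone. The summand `s` on the right of the size condition expresses this
-- without subtraction.
extract : ∀ h (R : VSet n) D s (P : VSet n → Set) → Hereditary P →
  (∀ R′ → R′ ⊑ R → D ≤ size R′ → ∃ (Piece R′ s P)) →
  D + h * s ≤ size R + s →
  ∃ λ (c : Fin n → Fin (suc h)) → ∀ a → Piece R s P (cls c (suc a))
extract zero R D s P P-her find large = (λ _ → zero) , λ ()
extract {n} (suc h) R D s P P-her find large = go (find R (λ _ t → t) (≤-trans (m≤m+n D (h * s)) D+hs≤R))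
  where
  shift : ∀ a b c → a + b + c ≡ a + (c + b)
  shift = solve-∀
  D+hs≤R : D + h * s ≤ size R
  D+hs≤R = +-cancelʳ-≤ s _ _ (≤-trans (≤-reflexive (shift D (h * s) s)) large)
  go : ∃ (Piece R s P) → ∃ λ (c : Fin n → Fin (suc (suc h))) → ∀ a → Piece R s P (cls c (suc a))
  go (W , piece@(W≡s , W⊑R , _)) with c , pieces ← extract h (R ∖ W) D s P P-her
       (λ R′ R′⊑ → find R′ λ x t → ∧-elimˡ (R′⊑ x t))
       (≤-trans D+hs≤R (≤-reflexive (trans (size-∖ W⊑R) (trans (cong (_+ size (R ∖ W)) W≡s) (+-comm s _)))))
    = (λ x → merge (W x) (c x)) , merge-pieces {R = R} P-her piece c pieces

module _ (p : Fin n → Fin (suc q)) (c : Fin q → Fin n → Fin (suc κ)) where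

  subdivide : Fin n → Fin (suc (q * κ))
  subdivide x = go (p x)
    module subdivide where
    label : Fin q → Fin (suc κ) → Fin (suc (q * κ))
    label i zero    = zero
    label i (suc a) = suc (combine i a)
    go : Fin (suc q) → Fin (suc (q * κ))
    go zero    = zero
    go (suc i) = label i (c i x)

  subdivide-elim : ∀ x i a → subdivide x ≡ suc (combine i a) → c i x ≡ suc a
  subdivide-elim x i a eq with p x
  ... | suc j with c j x in cj
  ...   | suc b with refl , refl ← FP.combine-injective j b i a (FP.suc-injective eq) = cj

  subdivide-intro : ∀ x i a → p x ≡ suc i → c i x ≡ suc a → subdivide x ≡ suc (combine i a)
  subdivide-intro x i a px cx rewrite px | cx = refl

  subdivide-pieces : ∀ {s} (P : Fin q → VSet n → Set) → (∀ i → Hereditary (P i)) →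
    (∀ i a → Piece (cls p (suc i)) s (P i) (cls (c i) (suc a))) →
    ∀ J → Piece (cls p (suc (quotient κ J))) s (P (quotient κ J)) (cls subdivide (suc J))
  subdivide-pieces {s} P P-her pieces J = subst (λ z → Piece (cls p (suc (quotient κ J))) s (P (quotient κ J)) (cls subdivide (suc z)))
    (FP.combine-remQuot {q} κ J) (piece (quotient κ J) (remainder {q} κ J))
    where
    piece : ∀ i a → Piece (cls p (suc i)) s (P i) (cls subdivide (suc (combine i a)))
    piece i a = Piece-resp (P-her i)
      (λ x t → cls-intro (c i) (subdivide-elim x i a (cls-elim subdivide t)))
      (λ x t → cls-intro subdivide (subdivide-intro x i a (cls-elim p (proj₁ (proj₂ (pieces i a)) x t)) (cls-elim (c i) t)))
      (pieces i a)

-- Serves both refinements of the proof, with `Homogeneous` in the energy step and with `Sparse`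
-- afterwards. The `h` pieces of class `i` are those `J` with `quotient h J` equal to `i`; all
-- leftovers join class 0.
refine : (p : Fin n → Fin (suc q)) → ∀ h D s (P : Fin q → VSet n → Set) → (∀ i → Hereditary (P i)) →
  (∀ i R → R ⊑ cls p (suc i) → D ≤ size R → ∃ (Piece R s (P i))) →
  (∀ i → D + h * s ≤ size (cls p (suc i)) + s) →
  ∃ λ (p′ : Fin n → Fin (suc (q * h))) → ∀ J → Piece (cls p (suc (quotient h J))) s (P (quotient h J)) (cls p′ (suc J))
refine {n} {q} p h D s P P-her find large =
  subdivide p (λ i → proj₁ (ex i)) , subdivide-pieces p (λ i → proj₁ (ex i)) P P-her (λ i → proj₂ (ex i))
  where
  ex : ∀ i → ∃ λ (c : Fin n → Fin (suc h)) → ∀ a → Piece (cls p (suc i)) s (P i) (cls c (suc a))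
  ex i = extract h (cls p (suc i)) D s (P i) (P-her i) (find i) (large i)

-- The exceptional class itself is cut by `extract` into `q` arbitrary sets of size `t`, and the
-- piece with label `i` joins class `i`.
distribute : (p : Fin n → Fin (suc q)) → ∀ s t → (∀ i → size (cls p (suc i)) ≡ s) → q * t ≤ size (cls p zero) →
  ∃ λ (p′ : Fin n → Fin (suc q)) → ∀ i → size (cls p′ (suc i)) ≡ s + t × cls p (suc i) ⊑ cls p′ (suc i)
distribute {n} {q} p s t sizes room = go (extract q (cls p zero) t t (λ _ → ⊤) (λ _ _ → tt)
    (λ R _ t≤R → let W , W⊑R , W≡t = subset-of-size R t t≤R in W , W≡t , W⊑R , tt)
    (≤-trans (+-monoʳ-≤ t room) (≤-reflexive (+-comm t _))))
  where
  pick : Fin (suc q) → Fin (suc q) → Fin (suc q)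
  pick zero    b = b
  pick (suc i) _ = suc i
  go : (∃ λ (c : Fin n → Fin (suc q)) → ∀ a → Piece (cls p zero) t (λ _ → ⊤) (cls c (suc a))) →
    ∃ λ (p′ : Fin n → Fin (suc q)) → ∀ i → size (cls p′ (suc i)) ≡ s + t × cls p (suc i) ⊑ cls p′ (suc i)
  go (c , pieces) = p′ , λ i → size≡ i , λ x u → cls-intro p′ (cong (λ d → pick d (c x)) (cls-elim p u))
    where
    p′ : Fin n → Fin (suc q)
    p′ x = pick (p x) (c x)
    pointwise : ∀ i x → 𝟙 (cls p′ (suc i) x) ≡ 𝟙 (cls p (suc i) x) + 𝟙 (cls c (suc i) x)
    pointwise i x with p x in px
    ... | zero  = refl
    ... | suc j with c x F.≟ suc i
    ...   | no _  = sym (+-identityʳ _)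
    ...   | yes e with () ← trans (sym px) (cls-elim p (proj₁ (proj₂ (pieces i)) x (cls-intro c e)))
    size≡ : ∀ i → size (cls p′ (suc i)) ≡ s + t
    size≡ i = trans (sum-cong (pointwise i)) (trans (sum-+ _ _) (cong₂ _+_ (sizes i) (proj₁ (pieces i))))

total-size : (p : Fin n → Fin (suc q)) → ∀ m → (∀ i → size (cls p (suc i)) ≡ m) → n ≡ size (cls p zero) + q * m
total-size {n} {q} p m sizes = begin
  n                                              ≡⟨ size-full n ⟨
  sum {n} (λ _ → 1)                              ≡⟨ sum-classes p (λ _ → 1) ⟨
  sum (λ c → sum (λ x → 𝟙 (cls p c x) * 1))      ≡⟨ sum-cong (λ c → sum-cong λ x → *-identityʳ (𝟙 (cls p c x))) ⟩
  sum (λ c → size (cls p c))                     ≡⟨ sum-∷ _ ⟩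
  size (cls p zero) + sum (λ i → size (cls p (suc i))) ≡⟨ cong (size (cls p zero) +_) (trans (sum-cong sizes) (sum-const q m)) ⟩
  size (cls p zero) + q * m                      ∎
  where open ≡-Reasoning

-- M * B₁ pieces of size s ≈ m / (M * (1 + B₁)) are taken from each of q classes of size m.
leftover-bound : ∀ {n z z′ q m s} M B₁ → let B = suc B₁; L = M * B in
  n ≡ z + q * m → n ≡ z′ + q * (M * B₁) * s → L * s ≤ m → m ≤ L * s + L → B * (q * L) ≤ n →
  B * z′ ≤ B * z + 2 * n
leftover-bound {n} {z} {z′} {q} {m} {s} M B₁ n≡ n≡′ Ls≤m m≤ large = +-cancelʳ-≤ (B * (q * (M * B₁) * s)) _ _ (begin
  B * z′ + B * (q * (M * B₁) * s)              ≡⟨ *-distribˡ-+ B z′ _ ⟨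
  B * (z′ + q * (M * B₁) * s)                  ≡⟨ cong (B *_) (trans (sym n≡′) n≡) ⟩
  B * (z + q * m)                              ≤⟨ *-monoʳ-≤ B (+-monoʳ-≤ z (*-monoʳ-≤ q m≤)) ⟩
  B * (z + q * (L * s + L))                    ≡⟨ expand B₁ z q M s ⟩
  B * z + (q * (L * s) + B * (q * L)) + B * (q * (M * B₁) * s)
    ≤⟨ +-monoˡ-≤ _ (+-monoʳ-≤ (B * z) (+-mono-≤ (≤-trans (*-monoʳ-≤ q Ls≤m) qm≤n) large)) ⟩
  B * z + (n + n) + B * (q * (M * B₁) * s)     ≡⟨ cong (λ w → B * z + (n + w) + B * (q * (M * B₁) * s)) (+-identityʳ n) ⟨
  B * z + 2 * n + B * (q * (M * B₁) * s)       ∎)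
  where
  open ≤-Reasoning
  B = suc B₁
  L = M * B
  qm≤n : q * m ≤ n
  qm≤n = ≤-trans (m≤n+m (q * m) z) (≤-reflexive (sym n≡))
  expand : ∀ B₁ z q M s → suc B₁ * (z + q * (M * suc B₁ * s + M * suc B₁)) ≡
    suc B₁ * z + (q * (M * suc B₁ * s) + suc B₁ * (q * (M * suc B₁))) + suc B₁ * (q * (M * B₁) * s)
  expand = solve-∀

-- Each test set splits `R` in two, and a part with at least half of the required size is kept. The
-- pigeonhole principle thus finds a large part of one atom of the generated Boolean algebra without
-- listing the atoms.
homogeneous : ∀ ℓ (T : Fin ℓ → VSet n) (R : VSet n) s → 2 ^ ℓ * s ≤ size R →
  ∃ λ R′ → R′ ⊑ R × s ≤ size R′ × ∀ k → ∃ λ b → ∀ x → R′ x ≡ true → T k x ≡ b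
homogeneous zero T R s large = R , (λ _ t → t) , ≤-trans (≤-reflexive (sym (*-identityˡ s))) large , λ ()
homogeneous {n} (suc ℓ) T R s large with 2 ^ ℓ * s ≤? size (R ∩ T zero)
... | yes big with R′ , R′⊑ , s≤ , hom ← homogeneous ℓ (T ∘ suc) (R ∩ T zero) s big
  = R′ , (λ x t → ∧-elimˡ (R′⊑ x t)) , s≤ ,
    λ { zero → true , λ x t → ∧-elimʳ {R x} (R′⊑ x t) ; (suc k) → hom k }
... | no ≰ = let R′ , R′⊑ , s≤ , hom = homogeneous ℓ (T ∘ suc) (R ∖ T zero) s big in
    R′ , (λ x t → ∧-elimˡ (R′⊑ x t)) , s≤ ,
    λ { zero → false , (λ x t → not-true⇒false (∧-elimʳ {R x} (R′⊑ x t))) ; (suc k) → hom k }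
  where
  open ≤-Reasoning
  double : ∀ a s → a * s + a * s ≡ 2 * a * s
  double = solve-∀
  big : 2 ^ ℓ * s ≤ size (R ∖ T zero)
  big = +-cancelˡ-≤ (2 ^ ℓ * s) _ _ (begin
    2 ^ ℓ * s + 2 ^ ℓ * s                   ≡⟨ double (2 ^ ℓ) s ⟩
    2 ^ suc ℓ * s                           ≤⟨ large ⟩
    size R                                  ≡⟨ size-split R (T zero) ⟩
    size (R ∩ T zero) + size (R ∖ T zero)   ≤⟨ +-monoˡ-≤ _ (<⇒≤ (≰⇒> ≰)) ⟩
    2 ^ ℓ * s + size (R ∖ T zero)           ∎)

-- Regularity

sqd : ℕ → ℕ → ℕ
sqd u a = ∣ u - a ∣ * ∣ u - a ∣

-- The expansion of `(u - a - 1)²`, with the negative terms moved across so that it holds in ℕ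
-- whichever of `u` and `a` is larger.
sqd-suc : ∀ u a → sqd u (suc a) + 2 * u ≡ sqd u a + suc (2 * a)
sqd-suc zero    a       = lem a
  where
  lem : ∀ a → suc a * suc a + 0 ≡ a * a + suc (2 * a)
  lem = solve-∀
sqd-suc (suc zero)    zero = refl
sqd-suc (suc (suc u)) zero = lem u
  where
  lem : ∀ u → suc u * suc u + 2 * suc (suc u) ≡ suc (suc u) * suc (suc u) + 1
  lem = solve-∀
sqd-suc (suc u) (suc a) = begin
  sqd u (suc a) + 2 * suc u      ≡⟨ l₁ (sqd u (suc a)) u ⟩
  sqd u (suc a) + 2 * u + 2      ≡⟨ cong (_+ 2) (sqd-suc u a) ⟩
  sqd u a + suc (2 * a) + 2      ≡⟨ l₂ (sqd u a) a ⟩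
  sqd u a + suc (2 * suc a)      ∎
  where
  open ≡-Reasoning
  l₁ : ∀ x u → x + 2 * suc u ≡ x + 2 * u + 2
  l₁ = solve-∀
  l₂ : ∀ x a → x + suc (2 * a) + 2 ≡ x + suc (2 * suc a)
  l₂ = solve-∀

module _ (f : Fin n → Fin n → Bool) (N : ℕ) where

  Up Down : ℕ → ℕ → VSet n → VSet n → Set
  Up   a m X Y = a * (size X * size Y) + m * m < N * e[ f ] X Y
  Down a m X Y = N * e[ f ] X Y + m * m < a * (size X * size Y)

  -- |e(X,Y) - (a/N)|X||Y|| ≤ Q/N for all X ⊆ U and Y ⊆ V.
  Near : ℕ → ℕ → VSet n → VSet n → Set
  Near a Q U V = ∀ X Y → X ⊑ U → Y ⊑ V →
    N * e[ f ] X Y ≤ a * (size X * size Y) + Q × a * (size X * size Y) ≤ N * e[ f ] X Y + Q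

  Regular : ℕ → ℕ → VSet n → VSet n → Set
  Regular a m = Near a (m * m)

  data Verdict (a m : ℕ) (U V : VSet n) : Set where
    regular : Regular a m U V → Verdict a m U V
    up      : ∀ X Y → X ⊑ U → Y ⊑ V → Up a m X Y → Verdict a m U V
    down    : ∀ X Y → X ⊑ U → Y ⊑ V → Down a m X Y → Verdict a m U V

  private
    e-cong : ∀ {X X′ Y Y′} → X ≗ X′ → Y ≗ Y′ → e[ f ] X Y ≡ e[ f ] X′ Y′
    e-cong hX hY = ∑∑-cong λ x y → cong₂ (λ a b → 𝟙 (a ∧ b ∧ f x y)) (hX x) (hY y)

    trace : ∀ {X U : VSet n} → X ⊑ U → X ≗ lookup (tabulate X) ∩ U
    trace {X} {U} X⊑U x rewrite lookup∘tabulate X x with X x in eq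
    ... | true  = sym (X⊑U x eq)
    ... | false = refl

  -- Exhaustive search over pairs of subsets. Intersecting them with `U` and `V` makes every
  -- violation found admissible, and by `trace` none is missed.
  classify : ∀ a m U V → Verdict a m U V
  classify a m U V with anySubset? (λ X → anySubset? λ Y →
      a * (size (lookup X ∩ U) * size (lookup Y ∩ V)) + m * m <? N * e[ f ] (lookup X ∩ U) (lookup Y ∩ V))
  ... | yes (X , Y , viol) = up (lookup X ∩ U) (lookup Y ∩ V) (λ x → ∧-elimʳ) (λ x → ∧-elimʳ) viol
  ... | no ¬up with anySubset? (λ X → anySubset? λ Y →
      N * e[ f ] (lookup X ∩ U) (lookup Y ∩ V) + m * m <? a * (size (lookup X ∩ U) * size (lookup Y ∩ V)))
  ...   | yes (X , Y , viol) = down (lookup X ∩ U) (lookup Y ∩ V) (λ x → ∧-elimʳ) (λ x → ∧-elimʳ) viol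
  ...   | no ¬down = regular λ X Y X⊑U Y⊑V →
          ≮⇒≥ (λ lt → ¬up (tabulate X , tabulate Y , subst₂ _<_
            (cong₂ (λ s t → a * (s * t) + m * m) (size-cong (trace X⊑U)) (size-cong (trace Y⊑V)))
            (cong (N *_) (e-cong (trace X⊑U) (trace Y⊑V))) lt)) ,
          ≮⇒≥ (λ lt → ¬down (tabulate X , tabulate Y , subst₂ _<_
            (cong (λ s → N * s + m * m) (e-cong (trace X⊑U) (trace Y⊑V)))
            (cong₂ (λ s t → a * (s * t)) (size-cong (trace X⊑U)) (size-cong (trace Y⊑V))) lt))

  -- This is `N²` times the squared L² distance between `f` and `A / N`.
  energy : (Fin n → Fin n → ℕ) → ℕ
  energy A = ∑∑ λ x y → sqd (N * 𝟙 (f x y)) (A x y)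

  block : VSet n → VSet n → (Fin n → Fin n → ℕ) → ℕ
  block U V A = ∑∑ λ x y → 𝟙 (U x) * (𝟙 (V y) * sqd (N * 𝟙 (f x y)) (A x y))

  block-cong : ∀ U V {A A′} → (∀ x y → U x ≡ true → V y ≡ true → A x y ≡ A′ x y) → block U V A ≡ block U V A′
  block-cong U V {A} {A′} h = ∑∑-cong pointwise
    where
    pointwise : ∀ x y → 𝟙 (U x) * (𝟙 (V y) * sqd (N * 𝟙 (f x y)) (A x y)) ≡ 𝟙 (U x) * (𝟙 (V y) * sqd (N * 𝟙 (f x y)) (A′ x y))
    pointwise x y with U x in u | V y in v
    ... | false | _     = refl
    ... | true  | false = refl
    ... | true  | true  rewrite h x y u v = refl

  energy-blocks : (p : Fin n → Fin q) → ∀ A → ∑∑ (λ c c′ → block (cls p c) (cls p c′) A) ≡ energy A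
  energy-blocks p A = trans (sum-cong row) (sum-classes p (λ x → sum (F x)))
    where
    open ≡-Reasoning
    F : Fin n → Fin n → ℕ
    F x y = sqd (N * 𝟙 (f x y)) (A x y)
    row : ∀ c → sum (λ c′ → block (cls p c) (cls p c′) A) ≡ sum (λ x → 𝟙 (cls p c x) * sum (F x))
    row c = begin
      sum (λ c′ → sum λ x → sum λ y → 𝟙 (cls p c x) * (𝟙 (cls p c′ y) * F x y))
        ≡⟨ sum-swap _ ⟩
      sum (λ x → sum λ c′ → sum λ y → 𝟙 (cls p c x) * (𝟙 (cls p c′ y) * F x y))
        ≡⟨ sum-cong (λ x → ∑∑-*ˡ (𝟙 (cls p c x)) (λ c′ y → 𝟙 (cls p c′ y) * F x y)) ⟩
      sum (λ x → 𝟙 (cls p c x) * sum (λ c′ → sum λ y → 𝟙 (cls p c′ y) * F x y))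
        ≡⟨ sum-cong (λ x → cong (𝟙 (cls p c x) *_) (sum-classes p (F x))) ⟩
      sum (λ x → 𝟙 (cls p c x) * sum (F x)) ∎

  module _ {U V X Y : VSet n} (X⊑U : X ⊑ U) (Y⊑V : Y ⊑ V) where

    -- `sqd-suc` summed over the block: on `X × Y` the values are `b` for `A` and `suc b` for `A′`,
    -- elsewhere they agree. As an identity it can be read both ways; `down-step` applies it with
    -- the two matrices exchanged.
    exchange : ∀ b {A A′ : Fin n → Fin n → ℕ} →
      (∀ x y → U x ≡ true → V y ≡ true →
        sqd (N * 𝟙 (f x y)) (A′ x y) + 𝟙 (X x) * 𝟙 (Y y) * (2 * (N * 𝟙 (f x y))) ≡
        sqd (N * 𝟙 (f x y)) (A x y) + 𝟙 (X x) * 𝟙 (Y y) * suc (2 * b)) →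
      block U V A′ + 2 * (N * e[ f ] X Y) ≡ block U V A + suc (2 * b) * (size X * size Y)
    exchange b {A} {A′} h = begin
      block U V A′ + 2 * (N * e[ f ] X Y)
        ≡⟨ cong (block U V A′ +_) (trans (∑∑-*ˡ 2 (λ x y → N * 𝟙 (X x ∧ Y y ∧ f x y)))
             (cong (2 *_) (∑∑-*ˡ N (λ x y → 𝟙 (X x ∧ Y y ∧ f x y))))) ⟨
      block U V A′ + ∑∑ (λ x y → 2 * (N * 𝟙 (X x ∧ Y y ∧ f x y)))
        ≡⟨ ∑∑-+ _ _ ⟨
      ∑∑ (λ x y → 𝟙 (U x) * (𝟙 (V y) * sqd (N * 𝟙 (f x y)) (A′ x y)) + 2 * (N * 𝟙 (X x ∧ Y y ∧ f x y)))
        ≡⟨ ∑∑-cong pointwise ⟩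
      ∑∑ (λ x y → 𝟙 (U x) * (𝟙 (V y) * sqd (N * 𝟙 (f x y)) (A x y)) + suc (2 * b) * (𝟙 (X x) * 𝟙 (Y y)))
        ≡⟨ ∑∑-+ _ _ ⟩
      block U V A + ∑∑ (λ x y → suc (2 * b) * (𝟙 (X x) * 𝟙 (Y y)))
        ≡⟨ cong (block U V A +_) (trans (∑∑-*ˡ (suc (2 * b)) _) (cong (suc (2 * b) *_) (∑∑-product (𝟙 ∘ X) (𝟙 ∘ Y)))) ⟩
      block U V A + suc (2 * b) * (size X * size Y) ∎
      where
      open ≡-Reasoning
      one : ∀ x → 1 * (1 * x) ≡ x
      one = solve-∀
      mask : ∀ a b c → a * b * (2 * (N * c)) ≡ 2 * (N * (a * (b * c)))
      mask a b c = lem a b c N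
        where
        lem : ∀ a b c N → a * b * (2 * (N * c)) ≡ 2 * (N * (a * (b * c)))
        lem = solve-∀
      empty : ∀ x y → X x ∧ Y y ≡ false → 2 * (N * 𝟙 (X x ∧ Y y ∧ f x y)) ≡ suc (2 * b) * (𝟙 (X x) * 𝟙 (Y y))
      empty x y h with X x | Y y
      ... | true  | false rewrite *-zeroʳ N = sym (*-zeroʳ (suc (2 * b)))
      ... | false | _     rewrite *-zeroʳ N = sym (*-zeroʳ (suc (2 * b)))
      pointwise : ∀ x y →
        𝟙 (U x) * (𝟙 (V y) * sqd (N * 𝟙 (f x y)) (A′ x y)) + 2 * (N * 𝟙 (X x ∧ Y y ∧ f x y)) ≡
        𝟙 (U x) * (𝟙 (V y) * sqd (N * 𝟙 (f x y)) (A x y)) + suc (2 * b) * (𝟙 (X x) * 𝟙 (Y y))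
      pointwise x y with U x in u | V y in v
      ... | true  | true  = begin
        1 * (1 * sqd u′ (A′ x y)) + 2 * (N * 𝟙 (X x ∧ Y y ∧ f x y))
          ≡⟨ cong₂ _+_ (one _) (trans (cong (λ w → 2 * (N * w))
                 (trans (𝟙-∧ (X x) (Y y ∧ f x y)) (cong (𝟙 (X x) *_) (𝟙-∧ (Y y) (f x y)))))
               (sym (mask (𝟙 (X x)) (𝟙 (Y y)) (𝟙 (f x y))))) ⟩
        sqd u′ (A′ x y) + 𝟙 (X x) * 𝟙 (Y y) * (2 * (N * 𝟙 (f x y)))
          ≡⟨ h x y u v ⟩
        sqd u′ (A x y) + 𝟙 (X x) * 𝟙 (Y y) * suc (2 * b)
          ≡⟨ cong₂ _+_ (sym (one _)) (*-comm (𝟙 (X x) * 𝟙 (Y y)) (suc (2 * b))) ⟩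
        1 * (1 * sqd u′ (A x y)) + suc (2 * b) * (𝟙 (X x) * 𝟙 (Y y)) ∎
        where u′ = N * 𝟙 (f x y)
      ... | false | _     = empty x y (outside-X x y u)
        where
        outside-X : ∀ x y → U x ≡ false → X x ∧ Y y ≡ false
        outside-X x y u with X x in t
        ... | false = refl
        ... | true with () ← trans (sym u) (X⊑U x t)
      ... | true  | false = empty x y (outside-Y x y v)
        where
        outside-Y : ∀ x y → V y ≡ false → X x ∧ Y y ≡ false
        outside-Y x y v with X x | Y y in t
        ... | false | _     = refl
        ... | true  | false = refl
        ... | true  | true with () ← trans (sym v) (Y⊑V y t)

    module _ {m : ℕ} (U≡m : size U ≡ m) (V≡m : size V ≡ m) where

      private
        area : size X * size Y ≤ m * m
        area = *-mono-≤ (≤-trans (size-mono X⊑U) (≤-reflexive U≡m)) (≤-trans (size-mono Y⊑V) (≤-reflexive V≡m))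

      -- The block changes by `(2a + 1) S - 2 N E`, which `viol` makes at most `S - 2 m²`. Since
      -- `S ≤ m²` by `area`, a drop of `m²` is left: half of the violation pays for the second-order
      -- term `S`.
      up-step : ∀ a {A A′ : Fin n → Fin n → ℕ} →
        (∀ x y → U x ≡ true → V y ≡ true → A x y ≡ a) →
        (∀ x y → U x ≡ true → V y ≡ true → A′ x y ≡ (if X x ∧ Y y then suc a else a)) →
        Up a m X Y → block U V A′ + m * m ≤ block U V A
      up-step a {A} {A′} const new viol = +-cancelʳ-≤ (2 * (N * E)) _ _ (begin
        block U V A′ + m * m + 2 * (N * E)                   ≡⟨ l₁ (block U V A′) (m * m) (2 * (N * E)) ⟩
        block U V A′ + 2 * (N * E) + m * m
          ≡⟨ cong (_+ m * m) (exchange a {A} {A′} (λ x y u v → local (N * 𝟙 (f x y)) (X x) (Y y) (const x y u v) (new x y u v))) ⟩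
        block U V A + suc (2 * a) * S + m * m
          ≤⟨ +-monoˡ-≤ (m * m) (+-monoʳ-≤ (block U V A) (≤-reflexive (l₂ a S))) ⟩
        block U V A + (2 * (a * S) + S) + m * m
          ≤⟨ +-monoˡ-≤ (m * m) (+-monoʳ-≤ (block U V A) (+-monoʳ-≤ (2 * (a * S)) area)) ⟩
        block U V A + (2 * (a * S) + m * m) + m * m          ≡⟨ l₃ (block U V A) (a * S) (m * m) ⟩
        block U V A + 2 * (a * S + m * m)                    ≤⟨ +-monoʳ-≤ (block U V A) (*-monoʳ-≤ 2 (<⇒≤ viol)) ⟩
        block U V A + 2 * (N * E)                            ∎)
        where
        open ≤-Reasoning
        E = e[ f ] X Y
        S = size X * size Y
        l₁ : ∀ a b c → a + b + c ≡ a + c + b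
        l₁ = solve-∀
        l₂ : ∀ a s → suc (2 * a) * s ≡ 2 * (a * s) + s
        l₂ = solve-∀
        l₃ : ∀ b s m → b + (2 * s + m) + m ≡ b + 2 * (s + m)
        l₃ = solve-∀
        local : ∀ u s t {α α′} → α ≡ a → α′ ≡ (if s ∧ t then suc a else a) →
          sqd u α′ + 𝟙 s * 𝟙 t * (2 * u) ≡ sqd u α + 𝟙 s * 𝟙 t * suc (2 * a)
        local u true  true  refl refl = trans (cong (sqd u (suc a) +_) (*-identityˡ _))
          (trans (sqd-suc u a) (cong (sqd u a +_) (sym (*-identityˡ _))))
        local u true  false refl refl = refl
        local u false _     refl refl = refl

      down-step : ∀ a {A A′ : Fin n → Fin n → ℕ} →
        (∀ x y → U x ≡ true → V y ≡ true → A x y ≡ a) →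
        (∀ x y → U x ≡ true → V y ≡ true → A′ x y ≡ (if X x ∧ Y y then pred a else a)) →
        Down a m X Y → block U V A′ + m * m ≤ block U V A
      -- A violation from below of the value 0 would put a natural number below 0, so `pred` never
      -- truncates.
      down-step zero    _ _ ()
      down-step (suc b) {A} {A′} const new viol = +-cancelʳ-≤ (suc (2 * b) * S) _ _ (begin
        block U V A′ + m * m + suc (2 * b) * S               ≡⟨ l₁ (block U V A′) (m * m) (suc (2 * b) * S) ⟩
        block U V A′ + suc (2 * b) * S + m * m
          ≡⟨ cong (_+ m * m) (exchange b {A′} {A} (λ x y u v → local (N * 𝟙 (f x y)) (X x) (Y y) (const x y u v) (new x y u v))) ⟨
        block U V A + 2 * (N * E) + m * m                    ≤⟨ +-cancelʳ-≤ (m * m) _ _ (begin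
          block U V A + 2 * (N * E) + m * m + m * m            ≡⟨ l₃ (block U V A) (N * E) (m * m) ⟩
          block U V A + 2 * (N * E + m * m)                    ≤⟨ +-monoʳ-≤ (block U V A) (*-monoʳ-≤ 2 (<⇒≤ viol)) ⟩
          block U V A + 2 * (suc b * S)                        ≡⟨ l₂ (block U V A) b S ⟩
          block U V A + suc (2 * b) * S + S                    ≤⟨ +-monoʳ-≤ (block U V A + suc (2 * b) * S) area ⟩
          block U V A + suc (2 * b) * S + m * m                ∎) ⟩
        block U V A + suc (2 * b) * S                        ∎)
        where
        open ≤-Reasoning
        E = e[ f ] X Y
        S = size X * size Y
        l₁ : ∀ a b c → a + b + c ≡ a + c + b
        l₁ = solve-∀
        l₂ : ∀ D b s → D + 2 * (suc b * s) ≡ D + suc (2 * b) * s + s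
        l₂ = solve-∀
        l₃ : ∀ b s m → b + 2 * s + m + m ≡ b + 2 * (s + m)
        l₃ = solve-∀
        local : ∀ u s t {α α′} → α ≡ suc b → α′ ≡ (if s ∧ t then b else suc b) →
          sqd u α + 𝟙 s * 𝟙 t * (2 * u) ≡ sqd u α′ + 𝟙 s * 𝟙 t * suc (2 * b)
        local u true  true  refl refl = trans (cong (sqd u (suc b) +_) (*-identityˡ _))
          (trans (sqd-suc u b) (cong (sqd u b +_) (sym (*-identityˡ _))))
        local u true  false refl refl = refl
        local u false _     refl refl = refl

module _ {f : Fin n → Fin n → Bool} {N a m : ℕ} {U V : VSet n} where

  -- Empty masks for regular pairs allow a single update formula, and a single notion of
  -- homogeneity, for all pairs.
  maskˡ maskʳ : Verdict f N a m U V → VSet n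
  maskˡ (regular _)      = λ _ → false
  maskˡ (up   X _ _ _ _) = X
  maskˡ (down X _ _ _ _) = X
  maskʳ (regular _)      = λ _ → false
  maskʳ (up   _ Y _ _ _) = Y
  maskʳ (down _ Y _ _ _) = Y

  shift : Verdict f N a m U V → ℕ → ℕ
  shift (regular _)      = id
  shift (up   _ _ _ _ _) = suc
  shift (down _ _ _ _ _) = pred

  irregular : Verdict f N a m U V → Bool
  irregular (regular _)      = false
  irregular (up   _ _ _ _ _) = true
  irregular (down _ _ _ _ _) = true

  irregular-false : (v : Verdict f N a m U V) → irregular v ≡ false → Regular f N a m U V
  irregular-false (regular reg) _ = reg

  verdict-step : (v : Verdict f N a m U V) → size U ≡ m → size V ≡ m → {A A′ : Fin n → Fin n → ℕ} →
    (∀ x y → U x ≡ true → V y ≡ true → A x y ≡ a) →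
    (∀ x y → U x ≡ true → V y ≡ true → A′ x y ≡ (if maskˡ v x ∧ maskʳ v y then shift v a else a)) →
    block f N U V A′ + 𝟙 (irregular v) * (m * m) ≤ block f N U V A
  verdict-step (regular _) _ _ const new = ≤-reflexive (trans (+-identityʳ _)
    (block-cong f N U V λ x y u v → trans (new x y u v) (sym (const x y u v))))
  verdict-step (up X Y X⊑U Y⊑V viol) U≡m V≡m const new rewrite +-identityʳ (m * m) =
    up-step f N X⊑U Y⊑V U≡m V≡m a const new viol
  verdict-step (down X Y X⊑U Y⊑V viol) U≡m V≡m const new rewrite +-identityʳ (m * m) =
    down-step f N X⊑U Y⊑V U≡m V≡m a const new viol

-- approx / N is the current step-function approximation of the adjacency matrix f.
record State (f : Fin n → Fin n → Bool) (N q : ℕ) : Set where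
  field
    part   : Fin n → Fin (suc q)
    m      : ℕ
    sizes  : ∀ i → size (cls part (suc i)) ≡ m
    value  : Fin q → Fin q → ℕ
    approx : Fin n → Fin n → ℕ
    const  : ∀ i j x y → part x ≡ suc i → part y ≡ suc j → approx x y ≡ value i j

  exceptional : ℕ
  exceptional = size (cls part zero)

  verdict : ∀ i j → Verdict f N (value i j) m (cls part (suc i)) (cls part (suc j))
  verdict i j = classify f N (value i j) m (cls part (suc i)) (cls part (suc j))

  bad : Fin q → Fin q → Bool
  bad i j = irregular (verdict i j)

  #bad : ℕ
  #bad = ∑∑ λ i j → 𝟙 (bad i j)

  energyₛ : ℕ
  energyₛ = energy f N approx

  n≡ : n ≡ exceptional + q * m
  n≡ = total-size part m sizes

-- A class is tested by `q` masks as the first member of a pair and by `q` masks as the second, each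
-- time at the price of a factor `2 ^ q`.
atoms : ℕ → ℕ
atoms q = 2 ^ q * 2 ^ q

atoms≢0 : ∀ q → NonZero (atoms q)
atoms≢0 q = m*n≢0 (2 ^ q) (2 ^ q) {{m^n≢0 2 q}} {{m^n≢0 2 q}}

pieces : ℕ → ℕ → ℕ
pieces B₁ q = q * (atoms q * B₁)

module Step {f : Fin n → Fin n → Bool} {N : ℕ} (S : State f N q) where
  open State S

  update : Fin (suc q) → Fin (suc q) → Fin n → Fin n → ℕ → ℕ
  update (suc i) (suc j) x y a = if maskˡ (verdict i j) x ∧ maskʳ (verdict i j) y then shift (verdict i j) a else a
  update _       _       x y a = a

  approx′ : Fin n → Fin n → ℕ
  approx′ x y = update (part x) (part y) x y (approx x y)

  gain : Fin (suc q) → Fin (suc q) → ℕ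
  gain (suc i) (suc j) = 𝟙 (bad i j)
  gain _       _       = 0

  approx′≡ : ∀ i j x y → part x ≡ suc i → part y ≡ suc j →
    approx′ x y ≡ (if maskˡ (verdict i j) x ∧ maskʳ (verdict i j) y then shift (verdict i j) (value i j) else value i j)
  approx′≡ i j x y px py = trans (cong₂ (λ c c′ → update c c′ x y (approx x y)) px py)
    (cong (update (suc i) (suc j) x y) (const i j x y px py))

  block-step : ∀ c c′ →
    block f N (cls part c) (cls part c′) approx′ + gain c c′ * (m * m) ≤ block f N (cls part c) (cls part c′) approx
  block-step zero c′ = ≤-reflexive (trans (+-identityʳ _) (block-cong f N (cls part zero) (cls part c′) λ x y u v →
    cong (λ c → update c (part y) x y (approx x y)) (cls-elim part u)))
  block-step (suc i) zero = ≤-reflexive (trans (+-identityʳ _) (block-cong f N (cls part (suc i)) (cls part zero) λ x y u v →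
    cong₂ (λ c c′ → update c c′ x y (approx x y)) (cls-elim part u) (cls-elim part v)))
  block-step (suc i) (suc j) = verdict-step (verdict i j) (sizes i) (sizes j)
    (λ x y u v → const i j x y (cls-elim part u) (cls-elim part v))
    (λ x y u v → approx′≡ i j x y (cls-elim part u) (cls-elim part v))

  gain-total : ∑∑ gain ≡ #bad
  gain-total = begin
    sum (λ c → sum (gain c))                                  ≡⟨ sum-∷ _ ⟩
    sum (gain zero) + sum (λ i → sum (gain (suc i)))
      ≡⟨ cong₂ _+_ (sum-zero λ _ → refl) (sum-cong λ i → sum-∷ (gain (suc i))) ⟩
    #bad                                                      ∎
    where open ≡-Reasoning

  energy-step : energy f N approx′ + #bad * (m * m) ≤ energyₛ
  energy-step = begin
    energy f N approx′ + #bad * (m * m)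
      ≡⟨ cong₂ _+_ (energy-blocks f N part approx′) (cong (_* (m * m)) gain-total) ⟨
    ∑∑ (λ c c′ → block f N (cls part c) (cls part c′) approx′) + ∑∑ gain * (m * m)
      ≡⟨ cong (∑∑ (λ c c′ → block f N (cls part c) (cls part c′) approx′) +_)
           (trans (*-comm (∑∑ gain) (m * m)) (trans (sym (∑∑-*ˡ (m * m) gain)) (∑∑-cong λ c c′ → *-comm (m * m) (gain c c′)))) ⟩
    ∑∑ (λ c c′ → block f N (cls part c) (cls part c′) approx′) + ∑∑ (λ c c′ → gain c c′ * (m * m))
      ≡⟨ ∑∑-+ (λ c c′ → block f N (cls part c) (cls part c′) approx′) _ ⟨
    ∑∑ (λ c c′ → block f N (cls part c) (cls part c′) approx′ + gain c c′ * (m * m))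
      ≤⟨ ∑∑-mono block-step ⟩
    ∑∑ (λ c c′ → block f N (cls part c) (cls part c′) approx)
      ≡⟨ energy-blocks f N part approx ⟩
    energyₛ ∎
    where open ≤-Reasoning

  Homogeneous : Fin q → VSet n → Set
  Homogeneous i W = (∀ j → ∃ λ b → ∀ x → W x ≡ true → maskˡ (verdict i j) x ≡ b)
                  × (∀ j → ∃ λ b → ∀ x → W x ≡ true → maskʳ (verdict j i) x ≡ b)

  homogeneous-hereditary : ∀ i → Hereditary (Homogeneous i)
  homogeneous-hereditary i W′⊑W (l , r) =
    (λ j → proj₁ (l j) , λ x t → proj₂ (l j) x (W′⊑W x t)) ,
    (λ j → proj₁ (r j) , λ x t → proj₂ (r j) x (W′⊑W x t))

  find : ∀ s i R → R ⊑ cls part (suc i) → atoms q * s ≤ size R → ∃ (Piece R s (Homogeneous i))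
  find s i R _ large
    with R₁ , R₁⊑ , large₁ , l ← homogeneous q (λ j → maskˡ (verdict i j)) R (2 ^ q * s)
           (≤-trans (≤-reflexive (sym (*-assoc (2 ^ q) (2 ^ q) s))) large)
    with R₂ , R₂⊑ , large₂ , r ← homogeneous q (λ j → maskʳ (verdict j i)) R₁ s large₁
    with W , W⊑ , W≡s ← subset-of-size R₂ s large₂
    = W , W≡s , (λ x t → R₁⊑ x (R₂⊑ x (W⊑ x t))) ,
      (λ j → proj₁ (l j) , λ x t → proj₂ (l j) x (R₂⊑ x (W⊑ x t))) ,
      (λ j → proj₁ (r j) , λ x t → proj₂ (r j) x (W⊑ x t))

  -- The energy drop comes from `approx′` alone; the refinement only makes `approx′` constant on
  -- pairs of classes again. One part in `suc B₁` of each class, `atoms q * s` vertices, is the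
  -- reserve that `find` needs for the last cut.
  next : ∀ B₁ s → atoms q * suc B₁ * s ≤ m →
    Σ (State f N (pieces B₁ q)) λ S′ → State.m S′ ≡ s × State.energyₛ S′ + #bad * (m * m) ≤ energyₛ
  next B₁ s Ls≤m = go (refine part h (atoms q * s) s Homogeneous homogeneous-hereditary (find s) room)
    where
    open ≤-Reasoning
    h = atoms q * B₁
    l₁ : ∀ M b s → M * s + M * b * s ≡ M * suc b * s
    l₁ = solve-∀
    room : ∀ i → atoms q * s + h * s ≤ size (cls part (suc i)) + s
    room i = begin
      atoms q * s + h * s          ≡⟨ l₁ (atoms q) B₁ s ⟩
      atoms q * suc B₁ * s         ≤⟨ Ls≤m ⟩
      m                            ≡⟨ sizes i ⟨
      size (cls part (suc i))      ≤⟨ m≤m+n _ s ⟩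
      size (cls part (suc i)) + s  ∎
    go : (∃ λ (part′ : Fin n → Fin (suc (q * h))) → ∀ J →
           Piece (cls part (suc (quotient h J))) s (Homogeneous (quotient h J)) (cls part′ (suc J))) →
      Σ (State f N (q * h)) λ S′ → State.m S′ ≡ s × State.energyₛ S′ + #bad * (m * m) ≤ energyₛ
    go (part′ , piece) = S′ , refl , energy-step
      where
      value′ : Fin (q * h) → Fin (q * h) → ℕ
      value′ I J = let i = quotient h I; j = quotient h J
                       _ , _ , l , _ = piece I; _ , _ , _ , r = piece J in
        if proj₁ (l j) ∧ proj₁ (r i) then shift (verdict i j) (value i j) else value i j
      const′ : ∀ I J x y → part′ x ≡ suc I → part′ y ≡ suc J → approx′ x y ≡ value′ I J
      const′ I J x y px py = let _ , ⊑I , l , _ = piece I; _ , ⊑J , _ , r = piece J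
                                 j = quotient h J; i = quotient h I
                                 tx = cls-intro part′ px; ty = cls-intro part′ py in
        trans (approx′≡ i j x y (cls-elim part (⊑I x tx)) (cls-elim part (⊑J y ty)))
          (cong₂ (λ b b′ → if b ∧ b′ then shift (verdict i j) (value i j) else value i j)
            (proj₂ (l j) x tx) (proj₂ (r i) y ty))
      S′ : State f N (q * h)
      S′ = record { part = part′ ; m = s ; sizes = λ J → proj₁ (piece J) ; value = value′ ; approx = approx′ ; const = const′ }

majority : ∀ {n z w} → n ≡ z + w → 2 * z ≤ n → n ≤ 2 * w
majority {n} {z} {w} n≡ 2z≤n = +-cancelʳ-≤ n _ _ (begin
  n + n            ≡⟨ cong₂ _+_ n≡ n≡ ⟩
  z + w + (z + w)  ≡⟨ l₁ z w ⟩
  2 * w + 2 * z    ≤⟨ +-monoʳ-≤ (2 * w) 2z≤n ⟩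
  2 * w + n        ∎)
  where
  open ≤-Reasoning
  l₁ : ∀ z w → z + w + (z + w) ≡ 2 * w + 2 * z
  l₁ = solve-∀

module Iterate (E T B₁ : ℕ) (4T≤B : 4 * T ≤ suc B₁) (1≤T : 1 ≤ T) where

  maxParts : ℕ → ℕ → ℕ
  maxParts zero    q = 0
  maxParts (suc t) q = q ⊔ maxParts t (pieces B₁ q)

  -- Rounding the quotient of the class size by `atoms q * suc B₁` can waste that many vertices in
  -- each of the `q` classes; from this order on the waste is at most `n / suc B₁` at every stage.
  minOrder : ℕ → ℕ → ℕ
  minOrder zero    q = 0
  minOrder (suc t) q = suc B₁ * (q * (atoms q * suc B₁)) ⊔ minOrder t (pieces B₁ q)

  Regularised : (Fin n → Fin n → Bool) → ℕ → ℕ → Set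
  Regularised {n} f N K = ∃ λ q → q ≤ K × Σ (State f N q) λ S →
    E * State.#bad S ≤ q * q × suc B₁ * State.exceptional S ≤ 2 * (T * n)

  -- By `4 * T ≤ suc B₁`, the `T` allowances of `2 n / suc B₁` exceptional vertices add up to at
  -- most `n / 2`.
  half : ∀ {f : Fin n → Fin n → Bool} {N} (S : State f N q) →
    suc B₁ * State.exceptional S ≤ 2 * (T * n) → n ≤ 2 * (q * State.m S)
  half {n} {q} S small = majority {z = State.exceptional S} {w = q * State.m S} (State.n≡ S) 2z≤n
    where
    open ≤-Reasoning
    open State S
    z = exceptional
    l₂ : ∀ T z → 2 * T * (2 * z) ≡ 4 * T * z
    l₂ = solve-∀
    2z≤n : 2 * z ≤ n
    2z≤n = *-cancelˡ-≤ (2 * T) {{m*n≢0 2 T {{_}} {{>-nonZero 1≤T}}}} (begin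
      2 * T * (2 * z)  ≡⟨ l₂ T z ⟩
      4 * T * z        ≤⟨ *-monoˡ-≤ z 4T≤B ⟩
      suc B₁ * z       ≤⟨ small ⟩
      2 * (T * n)      ≡⟨ *-assoc 2 T n ⟨
      2 * T * n        ∎)

  -- More than `q² / E` irregular pairs, worth `m²` each, lower the energy by at least
  -- `(q m)² / E ≥ n² / (4 E)`.
  energy-drop : ∀ {n q m b D D′} → n ≤ 2 * (q * m) → q * q < E * b → D′ + b * (m * m) ≤ D →
    4 * (E * D′) + n * n ≤ 4 * (E * D)
  energy-drop {n} {q} {m} {b} {D} {D′} n≤ many drop = begin
    4 * (E * D′) + n * n                          ≤⟨ +-monoʳ-≤ (4 * (E * D′)) (*-mono-≤ n≤ n≤) ⟩
    4 * (E * D′) + 2 * (q * m) * (2 * (q * m))    ≡⟨ cong (4 * (E * D′) +_) (l₁ q m) ⟩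
    4 * (E * D′) + 4 * (q * q * (m * m))          ≤⟨ +-monoʳ-≤ (4 * (E * D′)) (*-monoʳ-≤ 4 (*-monoˡ-≤ (m * m) (<⇒≤ many))) ⟩
    4 * (E * D′) + 4 * (E * b * (m * m))          ≡⟨ l₂ E D′ b (m * m) ⟩
    4 * (E * (D′ + b * (m * m)))                  ≤⟨ *-monoʳ-≤ 4 (*-monoʳ-≤ E drop) ⟩
    4 * (E * D)                                   ∎
    where
    open ≤-Reasoning
    l₁ : ∀ q m → 2 * (q * m) * (2 * (q * m)) ≡ 4 * (q * q * (m * m))
    l₁ = solve-∀
    l₂ : ∀ E D b m → 4 * (E * D) + 4 * (E * b * m) ≡ 4 * (E * (D + b * m))
    l₂ = solve-∀

  -- `t` counts the steps still available: the energy is below `t n² / (4 E)`, and the exceptional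
  -- class has used at most `T - t` of its `T` allowances. For `t = 0` the energy bound is absurd.
  iterate : ∀ t q {f : Fin n → Fin n → Bool} {N} (S : State f N q) → minOrder t q ≤ n →
    4 * (E * State.energyₛ S) < t * (n * n) →
    suc B₁ * State.exceptional S + 2 * (t * n) ≤ 2 * (T * n) →
    Regularised f N (maxParts t q)
  iterate zero    q S large () budget
  iterate {n} (suc t) q {f} {N} S large low budget with E * State.#bad S ≤? q * q
  ... | yes few = q , m≤m⊔n q _ , S , few , ≤-trans (m≤m+n _ _) budget
  ... | no many = go (Step.next S B₁ s Ls≤m)
    where
    open State S
    open ≤-Reasoning
    L = atoms q * suc B₁
    instance
      L≢0 : NonZero L
      L≢0 = m*n≢0 (atoms q) (suc B₁) {{atoms≢0 q}}
    s = m / L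
    m≡ : m ≡ m % L + L * s
    m≡ = trans (m≡m%n+[m/n]*n m L) (cong (m % L +_) (*-comm s L))
    Ls≤m : L * s ≤ m
    Ls≤m = ≤-trans (m≤n+m (L * s) (m % L)) (≤-reflexive (sym m≡))
    m≤Ls+L : m ≤ L * s + L
    m≤Ls+L = ≤-trans (≤-reflexive (trans m≡ (+-comm (m % L) _))) (+-monoʳ-≤ (L * s) (<⇒≤ (m%n<n m L)))
    go : Σ (State f N (pieces B₁ q)) (λ S′ → State.m S′ ≡ s × State.energyₛ S′ + #bad * (m * m) ≤ energyₛ) →
      Regularised f N (maxParts (suc t) q)
    go (S′ , m′≡ , drop) =
      let q′ , q′≤ , rest = iterate t (pieces B₁ q) S′ (≤-trans (m≤n⊔m _ _) large) low′ budget′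
      in q′ , ≤-trans q′≤ (m≤n⊔m q _) , rest
      where
      low′ : 4 * (E * State.energyₛ S′) < t * (n * n)
      low′ = +-cancelʳ-< (n * n) _ _ (begin-strict
        4 * (E * State.energyₛ S′) + n * n  ≤⟨ energy-drop {q = q} {m = m} (half S (≤-trans (m≤m+n _ _) budget)) (≰⇒> many) drop ⟩
        4 * (E * energyₛ)                   <⟨ low ⟩
        n * n + t * (n * n)                 ≡⟨ +-comm (n * n) _ ⟩
        t * (n * n) + n * n                 ∎)
      budget′ : suc B₁ * State.exceptional S′ + 2 * (t * n) ≤ 2 * (T * n)
      budget′ = begin
        suc B₁ * State.exceptional S′ + 2 * (t * n)
          ≤⟨ +-monoˡ-≤ (2 * (t * n)) (leftover-bound {q = q} {m = m} {s = s} (atoms q) B₁ n≡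
               (trans (State.n≡ S′) (cong (λ w → State.exceptional S′ + pieces B₁ q * w) m′≡))
               Ls≤m m≤Ls+L (≤-trans (m≤m⊔n _ _) large)) ⟩
        suc B₁ * exceptional + 2 * n + 2 * (t * n)
          ≡⟨ l₁ (suc B₁ * exceptional) n t ⟩
        suc B₁ * exceptional + 2 * (suc t * n)
          ≤⟨ budget ⟩
        2 * (T * n) ∎
        where
        l₁ : ∀ a n t → a + 2 * n + 2 * (t * n) ≡ a + 2 * (suc t * n)
        l₁ = solve-∀

regularity : ∀ N E H → ∃ λ K → ∃ λ n₀ → ∀ {n} (f : Fin n → Fin n → Bool) → n₀ ≤ n →
  ∃ λ q → q ≤ K × Σ (State f N q) λ S → E * State.#bad S ≤ q * q × 2 * H * State.exceptional S ≤ n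
regularity N E H = maxParts T 1 , 1 ⊔ minOrder T 1 , result
  where
  open ≤-Reasoning
  -- The zero approximation has energy at most `N² n²`, and each step consumes `n² / (4 E)`; the
  -- successor makes the initial bound strict.
  T = suc (4 * (E * (N * N)))
  -- Large enough that the final bound `2 T n / suc B₁` on the exceptional class is at most
  -- `n / (2 H)`; the successor of `H` keeps `4 * T ≤ suc B₁` true for `H = 0`.
  B₁ = 4 * T * suc H
  4T≤B : 4 * T ≤ suc B₁
  4T≤B = ≤-trans (m≤m*n (4 * T) (suc H)) (n≤1+n B₁)
  open Iterate E T B₁ 4T≤B (s≤s z≤n)
  result : ∀ {n} (f : Fin n → Fin n → Bool) → 1 ⊔ minOrder T 1 ≤ n →
    ∃ λ q → q ≤ maxParts T 1 × Σ (State f N q) λ S → E * State.#bad S ≤ q * q × 2 * H * State.exceptional S ≤ n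
  result {n} f large = let q , q≤ , S , few , small = iterate T 1 initial (≤-trans (m≤n⊔m 1 (minOrder T 1)) large) low budget in
    q , q≤ , S , few , *-cancelˡ-≤ (2 * T) (begin
      2 * T * (2 * H * State.exceptional S)      ≡⟨ l₁ T H (State.exceptional S) ⟩
      4 * T * H * State.exceptional S
        ≤⟨ *-monoˡ-≤ (State.exceptional S) (≤-trans (*-monoʳ-≤ (4 * T) (n≤1+n H)) (n≤1+n B₁)) ⟩
      suc B₁ * State.exceptional S               ≤⟨ small ⟩
      2 * (T * n)                                ≡⟨ *-assoc 2 T n ⟨
      2 * T * n                                  ∎)
    where
    l₁ : ∀ T H z → 2 * T * (2 * H * z) ≡ 4 * T * H * z
    l₁ = solve-∀
    initial : State f N 1
    initial = record
      { part = λ _ → suc zero ; m = n ; sizes = λ { zero → size-full n } ; value = λ _ _ → 0 ; approx = λ _ _ → 0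
      ; const = λ _ _ _ _ _ _ → refl }
    energy≤ : State.energyₛ initial ≤ N * N * (n * n)
    energy≤ = begin
      ∑∑ (λ x y → sqd (N * 𝟙 (f x y)) 0)  ≤⟨ ∑∑-mono (λ x y → pointwise (f x y)) ⟩
      ∑∑ {n} {n} (λ x y → N * N)          ≡⟨ trans (sum-cong λ x → sum-const n (N * N)) (sum-const n _) ⟩
      n * (n * (N * N))                   ≡⟨ l₂ n (N * N) ⟩
      N * N * (n * n)                     ∎
      where
      l₂ : ∀ n w → n * (n * w) ≡ w * (n * n)
      l₂ = solve-∀
      pointwise : ∀ b → sqd (N * 𝟙 b) 0 ≤ N * N
      pointwise b = *-mono-≤ le le
        where
        le : ∣ N * 𝟙 b - 0 ∣ ≤ N
        le = ≤-trans (≤-reflexive (∣-∣-identityʳ (N * 𝟙 b))) (≤-trans (*-monoʳ-≤ N (𝟙≤1 b)) (≤-reflexive (*-identityʳ N)))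
    low : 4 * (E * State.energyₛ initial) < T * (n * n)
    low = begin-strict
      4 * (E * State.energyₛ initial)      ≤⟨ *-monoʳ-≤ 4 (*-monoʳ-≤ E energy≤) ⟩
      4 * (E * (N * N * (n * n)))        ≡⟨ l₃ E (N * N) (n * n) ⟩
      4 * (E * (N * N)) * (n * n)        <⟨ m<n+m _ (*-mono-≤ 1≤n 1≤n) ⟩
      T * (n * n)                        ∎
      where
      1≤n = ≤-trans (m≤m⊔n 1 (minOrder T 1)) large
      l₃ : ∀ E a b → 4 * (E * (a * b)) ≡ 4 * (E * a) * b
      l₃ = solve-∀
    budget : suc B₁ * State.exceptional initial + 2 * (T * n) ≤ 2 * (T * n)
    budget = ≤-reflexive (cong (_+ 2 * (T * n)) (trans (cong (suc B₁ *_) (size-empty n)) (*-zeroʳ (suc B₁))))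

-- Rational bounds

module _ (p d : ℕ) .(c : Coprime p (suc d)) where

  private
    ε : ℚ
    ε = mkℚ (ℤ.+ p) d c

    toℚᵘ-ε* : ∀ b → toℚᵘ (ε ℚ.* ℕ→ℚ b) ℚᵘ.≃ mkℚᵘ (ℤ.+ p) d ℚᵘ.* mkℚᵘ (ℤ.+ b) 0
    toℚᵘ-ε* b = ℚᵘP.≃-trans (ℚP.toℚᵘ-homo-* ε (ℕ→ℚ b)) (ℚᵘP.*-congˡ {mkℚᵘ (ℤ.+ p) d} (ℚP.toℚᵘ-fromℚᵘ (mkℚᵘ (ℤ.+ b) 0)))

    lhs : ∀ a → ℤ.+ (a * suc d) ≡ (ℤ.+ a) ℤ.* (ℤ.+ (suc d * 1))
    lhs a = trans (cong (λ w → ℤ.+ (a * w)) (sym (*-identityʳ (suc d)))) (ℤP.pos-* a (suc d * 1))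

    rhs : ∀ b → ℤ.+ (p * b) ≡ ((ℤ.+ p) ℤ.* (ℤ.+ b)) ℤ.* (ℤ.+ 1)
    rhs b = trans (ℤP.pos-* p b) (sym (ℤP.*-identityʳ _))

  ≤ε*-intro : ∀ a b → a * suc d ≤ p * b → ℕ→ℚ a ℚ.≤ ε ℚ.* ℕ→ℚ b
  ≤ε*-intro a b le = ℚP.toℚᵘ-cancel-≤ (ℚᵘP.≤-respˡ-≃ (ℚᵘP.≃-sym (ℚP.toℚᵘ-fromℚᵘ (mkℚᵘ (ℤ.+ a) 0)))
    (ℚᵘP.≤-respʳ-≃ (ℚᵘP.≃-sym (toℚᵘ-ε* b)) (*≤* (subst₂ ℤ._≤_ (lhs a) (rhs b) (ℤ.+≤+ le)))))

  ≤ε*-elim : ∀ a b → ℕ→ℚ a ℚ.≤ ε ℚ.* ℕ→ℚ b → a * suc d ≤ p * b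
  ≤ε*-elim a b le with ℚᵘP.≤-respˡ-≃ (ℚP.toℚᵘ-fromℚᵘ (mkℚᵘ (ℤ.+ a) 0)) (ℚᵘP.≤-respʳ-≃ (toℚᵘ-ε* b) (ℚP.toℚᵘ-mono-≤ le))
  ... | *≤* le′ = ℤP.drop‿+≤+ (subst₂ ℤ._≤_ (sym (lhs a)) (sym (rhs b)) le′)

  ε*≤-elim : ∀ a b → ε ℚ.* ℕ→ℚ b ℚ.≤ ℕ→ℚ a → p * b ≤ a * suc d
  ε*≤-elim a b le with ℚᵘP.≤-respʳ-≃ (ℚP.toℚᵘ-fromℚᵘ (mkℚᵘ (ℤ.+ a) 0)) (ℚᵘP.≤-respˡ-≃ (toℚᵘ-ε* b) (ℚP.toℚᵘ-mono-≤ le))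
  ... | *≤* le′ = ℤP.drop‿+≤+ (subst₂ ℤ._≤_ (sym (rhs b)) (sym (lhs a)) le′)

  ratio<ratio+ε : ∀ e₁ m₁ e₂ m₂ → 1 ≤ m₁ → 1 ≤ m₂ → e₁ * (m₂ * suc d) < (e₂ * suc d + p * m₂) * m₁ →
    ratio e₁ m₁ ℚ.< ratio e₂ m₂ ℚ.+ ε
  ratio<ratio+ε e₁ (suc m₁) e₂ (suc m₂) _ _ lt = ℚP.toℚᵘ-cancel-<
    (ℚᵘP.<-respˡ-≃ (ℚᵘP.≃-sym (ℚP.toℚᵘ-fromℚᵘ (mkℚᵘ (ℤ.+ e₁) m₁)))
    (ℚᵘP.<-respʳ-≃ (ℚᵘP.≃-sym (ℚᵘP.≃-trans (ℚP.toℚᵘ-homo-+ (ratio e₂ (suc m₂)) ε)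
        (ℚᵘP.+-cong (ℚP.toℚᵘ-fromℚᵘ (mkℚᵘ (ℤ.+ e₂) m₂)) (ℚᵘP.≃-refl {mkℚᵘ (ℤ.+ p) d}))))
      (*<* (subst₂ ℤ._<_ (ℤP.pos-* e₁ _) eq (ℤ.+<+ lt)))))
    where
    eq : ℤ.+ ((e₂ * suc d + p * suc m₂) * suc m₁) ≡ ((ℤ.+ e₂) ℤ.* (ℤ.+ suc d) ℤ.+ (ℤ.+ p) ℤ.* (ℤ.+ suc m₂)) ℤ.* (ℤ.+ suc m₁)
    eq = trans (ℤP.pos-* (e₂ * suc d + p * suc m₂) (suc m₁)) (cong (ℤ._* (ℤ.+ suc m₁))
      (trans (ℤP.pos-+ (e₂ * suc d) (p * suc m₂)) (cong₂ ℤ._+_ (ℤP.pos-* e₂ (suc d)) (ℤP.pos-* p (suc m₂)))))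

<+⇒-< : ∀ u v ε → u ℚ.< v ℚ.+ ε → u ℚ.- v ℚ.< ε
<+⇒-< u v ε lt = subst (u ℚ.- v ℚ.<_) eq (ℚP.+-monoˡ-< (ℚ.- v) lt)
  where
  eq : v ℚ.+ ε ℚ.- v ≡ ε
  eq = trans (cong (ℚ._+ (ℚ.- v)) (ℚP.+-comm v ε)) (trans (ℚP.+-assoc ε v (ℚ.- v))
    (trans (cong (ε ℚ.+_) (ℚP.+-inverseʳ v)) (ℚP.+-identityʳ ε)))

∣-∣<-intro : ∀ u v ε → u ℚ.< v ℚ.+ ε → v ℚ.< u ℚ.+ ε → ℚ.∣ u ℚ.- v ∣ ℚ.< ε
∣-∣<-intro u v ε u< v< with ℚP.∣p∣≡p∨∣p∣≡-p (u ℚ.- v)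
... | inj₁ eq = subst (ℚ._< ε) (sym eq) (<+⇒-< u v ε u<)
... | inj₂ eq = subst (ℚ._< ε) (sym (trans eq neg)) (<+⇒-< v u ε v<)
  where
  neg : ℚ.- (u ℚ.- v) ≡ v ℚ.- u
  neg = ⁻¹-anti-homo‿- u v

-- ε only enters through a natural number E with 1/E ≤ ε.
record Scale (ε : ℚ) : Set where
  field
    E      : ℕ
    1≤E    : 1 ≤ E
    ≤-intro : ∀ a b → E * a ≤ b → ℕ→ℚ a ℚ.≤ ε ℚ.* ℕ→ℚ b
    ≤-elim  : ∀ a b → ε ℚ.* ℕ→ℚ b ℚ.≤ ℕ→ℚ a → b ≤ E * a
    close   : ∀ e₁ m₁ e₂ m₂ → 1 ≤ m₁ → 1 ≤ m₂ →
      E * (e₁ * m₂) < E * (e₂ * m₁) + m₁ * m₂ → E * (e₂ * m₁) < E * (e₁ * m₂) + m₁ * m₂ →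
      ℚ.∣ ratio e₁ m₁ ℚ.- ratio e₂ m₂ ∣ ℚ.< ε

-- The numerator of a positive ε is at least 1, so its denominator serves as `E`.
scale : ∀ ε → ℚ.Positive ε → Scale ε
scale (mkℚ (ℤ.+ suc p) d c) _ = record
  { E = suc d ; 1≤E = s≤s z≤n
  ; ≤-intro = λ a b le → ≤ε*-intro (suc p) d c a b (≤-trans (≤-reflexive (*-comm a (suc d))) (≤-trans le (m≤m+n b _)))
  ; ≤-elim = λ a b le → ≤-trans (m≤m+n b _) (≤-trans (ε*≤-elim (suc p) d c a b le) (≤-reflexive (*-comm a (suc d))))
  ; close = λ e₁ m₁ e₂ m₂ 1≤m₁ 1≤m₂ lt₁ lt₂ → ∣-∣<-intro (ratio e₁ m₁) (ratio e₂ m₂) _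
      (ratio<ratio+ε (suc p) d c e₁ m₁ e₂ m₂ 1≤m₁ 1≤m₂ (bound e₁ m₁ e₂ m₂ lt₁))
      (ratio<ratio+ε (suc p) d c e₂ m₂ e₁ m₁ 1≤m₂ 1≤m₁ (bound e₂ m₂ e₁ m₁
        (subst (λ w → suc d * (e₂ * m₁) < w) (cong (λ w → suc d * (e₁ * m₂) + w) (*-comm m₁ m₂)) lt₂)))
  }
  where
  open ≤-Reasoning
  bound : ∀ e₁ m₁ e₂ m₂ → suc d * (e₁ * m₂) < suc d * (e₂ * m₁) + m₁ * m₂ → e₁ * (m₂ * suc d) < (e₂ * suc d + suc p * m₂) * m₁
  bound e₁ m₁ e₂ m₂ lt = begin-strict
    e₁ * (m₂ * suc d)                         ≡⟨ l₁ e₁ m₂ (suc d) ⟩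
    suc d * (e₁ * m₂)                         <⟨ lt ⟩
    suc d * (e₂ * m₁) + m₁ * m₂               ≤⟨ m≤m+n _ (p * (m₁ * m₂)) ⟩
    suc d * (e₂ * m₁) + m₁ * m₂ + p * (m₁ * m₂) ≡⟨ l₂ (suc d) e₂ m₁ m₂ p ⟩
    (e₂ * suc d + suc p * m₂) * m₁            ∎
    where
    l₁ : ∀ a b c → a * (b * c) ≡ c * (a * b)
    l₁ = solve-∀
    l₂ : ∀ D e m₁ m₂ p → D * (e * m₁) + m₁ * m₂ + p * (m₁ * m₂) ≡ (e * D + suc p * m₂) * m₁
    l₂ = solve-∀

unit-fraction : ℕ → ℚ
unit-fraction R = mkℚ (ℤ.+ 1) R (1-coprimeTo (suc R))

≤unit-fraction-elim : ∀ R a b → ℕ→ℚ a ℚ.≤ unit-fraction R ℚ.* ℕ→ℚ b → suc R * a ≤ b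
≤unit-fraction-elim R a b le = subst₂ _≤_ (*-comm a (suc R)) (*-identityˡ b) (≤ε*-elim 1 R (1-coprimeTo (suc R)) a b le)

2*C2 : ∀ n → 2 * (suc n C 2) ≡ suc n * n
2*C2 zero    = refl
2*C2 (suc n) = begin
  2 * (suc (suc n) C 2)                ≡⟨ cong (2 *_) (nCk+nC[k+1]≡[n+1]C[k+1] (suc n) 1) ⟨
  2 * (suc n C 1 + suc n C 2)          ≡⟨ cong (λ w → 2 * (w + suc n C 2)) (nC1≡n (suc n)) ⟩
  2 * (suc n + suc n C 2)              ≡⟨ *-distribˡ-+ 2 (suc n) _ ⟩
  2 * suc n + 2 * (suc n C 2)          ≡⟨ cong (_+_ (2 * suc n)) (2*C2 n) ⟩
  2 * suc n + suc n * n                ≡⟨ l₁ n ⟩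
  suc (suc n) * suc n                  ∎
  where
  open ≡-Reasoning
  l₁ : ∀ n → 2 * suc n + suc n * n ≡ suc (suc n) * suc n
  l₁ = solve-∀

-- It fails for `n = 1`, which is why `Good` demands `2 ≤ μ`.
n²≤4*C2 : ∀ n → 2 ≤ n → n * n ≤ 4 * (n C 2)
n²≤4*C2 (suc (suc n)) _ = begin
  m * m                  ≤⟨ m≤m+n _ (m * n) ⟩
  m * m + m * n          ≡⟨ l₁ n ⟩
  2 * (m * suc n)        ≡⟨ cong (2 *_) (2*C2 (suc n)) ⟨
  2 * (2 * (m C 2))      ≡⟨ *-assoc 2 2 (m C 2) ⟨
  4 * (m C 2)            ∎
  where
  open ≤-Reasoning
  m = suc (suc n)
  l₁ : ∀ n → suc (suc n) * suc (suc n) + suc (suc n) * n ≡ 2 * (suc (suc n) * suc n)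
  l₁ = solve-∀
n²≤4*C2 (suc zero) (s≤s ())

-- From a regular partition to sparse classes

sum-↑ : ∀ a {b} (g : Fin (a + b) → ℕ) → sum g ≡ sum (λ i → g (i ↑ˡ b)) + sum (λ j → g (a ↑ʳ j))
sum-↑ zero    g = cong (_+ sum g) (sym (sum-[] _))
sum-↑ (suc a) {b} g = begin
  sum g                                                                    ≡⟨ sum-∷ g ⟩
  g zero + sum (g ∘ suc)                                                   ≡⟨ cong (g zero +_) (sum-↑ a (g ∘ suc)) ⟩
  g zero + (sum (λ i → g (suc i ↑ˡ b)) + sum (λ j → g (suc (a ↑ʳ j))))      ≡⟨ +-assoc (g zero) _ _ ⟨
  g zero + sum (λ i → g (suc i ↑ˡ b)) + sum (λ j → g (suc (a ↑ʳ j)))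
    ≡⟨ cong (_+ sum (λ j → g (suc (a ↑ʳ j)))) (sum-∷ (λ i → g (i ↑ˡ b))) ⟨
  sum (λ i → g (i ↑ˡ b)) + sum (λ j → g (suc (a ↑ʳ j)))                     ∎
  where open ≡-Reasoning

sum-combine : ∀ q h (g : Fin (q * h) → ℕ) → sum g ≡ ∑∑ {q} {h} λ i a → g (combine i a)
sum-combine zero    h g = trans (sum-[] g) (sym (sum-[] _))
sum-combine (suc q) h g = trans (sum-↑ h g)
  (trans (cong (sum (λ a → g (a ↑ˡ (q * h))) +_) (sum-combine q h (λ J → g (h ↑ʳ J)))) (sym (sum-∷ _)))

sum-quotient : ∀ q h (g : Fin q → ℕ) → sum {q * h} (λ J → g (quotient h J)) ≡ h * sum g
sum-quotient q h g = begin
  sum {q * h} (λ J → g (quotient h J))            ≡⟨ sum-combine q h _ ⟩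
  ∑∑ (λ i a → g (quotient h (combine i a)))
    ≡⟨ sum-cong (λ i → trans (sum-cong λ a → cong (g ∘ proj₁) (FP.remQuot-combine i a)) (sum-const h (g i))) ⟩
  sum (λ i → h * g i)                             ≡⟨ sum-*ˡ h g ⟩
  h * sum g                                       ∎
  where open ≡-Reasoning

∑∑-quotient : ∀ q h (g : Fin q → Fin q → ℕ) → ∑∑ {q * h} {q * h} (λ I J → g (quotient h I) (quotient h J)) ≡ h * h * ∑∑ g
∑∑-quotient q h g = begin
  sum (λ I → sum (λ J → g (quotient h I) (quotient h J)))  ≡⟨ sum-cong (λ I → sum-quotient q h (g (quotient h I))) ⟩
  sum (λ I → h * sum (g (quotient h I)))                   ≡⟨ sum-*ˡ h _ ⟩
  h * sum (λ I → sum (g (quotient h I)))                   ≡⟨ cong (h *_) (sum-quotient q h (λ i → sum (g i))) ⟩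
  h * (h * ∑∑ g)                                           ≡⟨ *-assoc h h _ ⟨
  h * h * ∑∑ g                                             ∎
  where open ≡-Reasoning

module _ (X Y W W′ : VSet n) where

  private boundary = size (X ∖ W) * size Y + size X * size (Y ∖ W′)

  -- A lost pair has its first vertex outside `W` or its second outside `W′`.
  e-trim : (f : Fin n → Fin n → Bool) → e[ f ] X Y ≤ e[ f ] (X ∩ W) (Y ∩ W′) + boundary
  e-trim f = begin
    e[ f ] X Y
      ≤⟨ ∑∑-mono (λ x y → pointwise (X x) (W x) (Y y) (W′ y) (f x y)) ⟩
    ∑∑ (λ x y → 𝟙 ((X ∩ W) x ∧ (Y ∩ W′) y ∧ f x y) + (𝟙 ((X ∖ W) x) * 𝟙 (Y y) + 𝟙 (X x) * 𝟙 ((Y ∖ W′) y)))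
      ≡⟨ trans (∑∑-+ _ _) (cong (e[ f ] (X ∩ W) (Y ∩ W′) +_) (trans (∑∑-+ _ _)
           (cong₂ _+_ (∑∑-product (𝟙 ∘ (X ∖ W)) (𝟙 ∘ Y)) (∑∑-product (𝟙 ∘ X) (𝟙 ∘ (Y ∖ W′)))))) ⟩
    e[ f ] (X ∩ W) (Y ∩ W′) + boundary ∎
    where
    open ≤-Reasoning
    pointwise : ∀ a w b w′ c → 𝟙 (a ∧ b ∧ c) ≤ 𝟙 ((a ∧ w) ∧ (b ∧ w′) ∧ c) + (𝟙 (a ∧ not w) * 𝟙 b + 𝟙 a * 𝟙 (b ∧ not w′))
    pointwise false w     b     w′    c = z≤n
    pointwise true  w     false w′    c = z≤n
    pointwise true  true  true  true  c = m≤m+n (𝟙 c) 0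
    pointwise true  true  true  false c = 𝟙≤1 c
    pointwise true  false true  w′    c = ≤-trans (𝟙≤1 c) (m≤m+n 1 _)

  area-trim : size X * size Y ≤ size (X ∩ W) * size (Y ∩ W′) + boundary
  area-trim = begin
    size X * size Y                                              ≡⟨ cong (_* size Y) (size-split X W) ⟩
    (x₁ + x₂) * size Y                                           ≡⟨ *-distribʳ-+ (size Y) x₁ x₂ ⟩
    x₁ * size Y + x₂ * size Y                                    ≡⟨ cong (λ w → x₁ * w + x₂ * size Y) (size-split Y W′) ⟩
    x₁ * (y₁ + y₂) + x₂ * size Y                                 ≡⟨ l₁ x₁ y₁ y₂ (x₂ * size Y) ⟩
    x₁ * y₁ + (x₂ * size Y + x₁ * y₂)
      ≤⟨ +-monoʳ-≤ (x₁ * y₁) (+-monoʳ-≤ (x₂ * size Y) (*-monoˡ-≤ y₂ (size-mono (∩⊑ˡ X W)))) ⟩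
    x₁ * y₁ + boundary                                           ∎
    where
    open ≤-Reasoning
    x₁ = size (X ∩ W)
    x₂ = size (X ∖ W)
    y₁ = size (Y ∩ W′)
    y₂ = size (Y ∖ W′)
    l₁ : ∀ a b c d → a * (b + c) + d ≡ a * b + (d + a * c)
    l₁ = solve-∀

size-∖-mono : {X U W : VSet n} {s t : ℕ} → X ⊑ U → W ⊑ U → size W ≡ s → size U ≡ s + t → size (X ∖ W) ≤ t
size-∖-mono {X = X} {U} {W} {s} {t} X⊑U W⊑U W≡s U≡ = ≤-trans
  (size-mono λ x u → ∧-intro (X⊑U x (∧-elimˡ u)) (∧-elimʳ {X x} u))
  (≤-reflexive (+-cancelˡ-≡ s _ _ (trans (cong (_+ size (U ∖ W)) (sym W≡s)) (trans (sym (size-∖ W⊑U)) U≡))))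

boundary-bound : ∀ {x x₂ y y₂ t μ} → x₂ ≤ t → y ≤ μ → x ≤ μ → y₂ ≤ t → x₂ * y + x * y₂ ≤ 2 * (t * μ)
boundary-bound {t = t} {μ} x₂≤ y≤ x≤ y₂≤ = ≤-trans (+-mono-≤ (*-mono-≤ x₂≤ y≤) (*-mono-≤ x≤ y₂≤)) (≤-reflexive (l₁ t μ))
  where
  l₁ : ∀ t μ → t * μ + μ * t ≡ 2 * (t * μ)
  l₁ = solve-∀

-- The unit steps of the iteration impose no cap on the values. For a regular pair, testing with the
-- whole classes gives `a ≤ N + 1`, and `regular-thicken` uses this to control the area it trims.
regular-value-bound : ∀ {f : Fin n → Fin n → Bool} {N a m U V} → 1 ≤ N → 1 ≤ m → size U ≡ m → size V ≡ m →
  Regular f N a m U V → a ≤ 2 * N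
regular-value-bound {f = f} {N} {a} {m} {U} {V} 1≤N 1≤m U≡m V≡m reg =
  *-cancelʳ-≤ a (2 * N) (m * m) {{m*n≢0 m m {{>-nonZero 1≤m}} {{>-nonZero 1≤m}}}} (begin
    a * (m * m)                       ≡⟨ cong₂ (λ x y → a * (x * y)) U≡m V≡m ⟨
    a * (size U * size V)             ≤⟨ proj₂ (reg U V (λ _ t → t) (λ _ t → t)) ⟩
    N * e[ f ] U V + m * m            ≤⟨ +-monoˡ-≤ (m * m) (*-monoʳ-≤ N (e≤size*size f U V)) ⟩
    N * (size U * size V) + m * m     ≡⟨ cong₂ (λ x y → N * (x * y) + m * m) U≡m V≡m ⟩
    N * (m * m) + m * m
      ≤⟨ +-monoʳ-≤ (N * (m * m)) (≤-trans (≤-reflexive (sym (*-identityˡ (m * m)))) (*-monoˡ-≤ (m * m) 1≤N)) ⟩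
    N * (m * m) + N * (m * m)         ≡⟨ l₁ N (m * m) ⟩
    2 * N * (m * m)                   ∎)
  where
  open ≤-Reasoning
  l₁ : ∀ N w → N * w + N * w ≡ 2 * N * w
  l₁ = solve-∀

-- `W` and `W′` are pieces of the old classes `U₀` and `V₀`, and `U` and `V` are these pieces with
-- `t` vertices added. Trimming test sets back to the pieces loses at most `2 t (s + t)` pairs, each
-- of weight at most `2 N`.
regular-thicken : ∀ {f : Fin n → Fin n → Bool} {N a m s t U U₀ W V V₀ W′} → a ≤ 2 * N →
  Regular f N a m U₀ V₀ → W ⊑ U₀ → W′ ⊑ V₀ → W ⊑ U → W′ ⊑ V →
  size W ≡ s → size W′ ≡ s → size U ≡ s + t → size V ≡ s + t →
  Near f N a (m * m + 4 * (N * (t * (s + t)))) U V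
regular-thicken {f = f} {N} {a} {m} {s} {t} {U} {U₀} {W} {V} {V₀} {W′} a≤2N reg W⊑U₀ W′⊑V₀ W⊑U W′⊑V W≡s W′≡s U≡ V≡ X Y X⊑U Y⊑V
  = (begin
      N * e[ f ] X Y                       ≤⟨ *-monoʳ-≤ N (≤-trans (e-trim X Y W W′ f) (+-monoʳ-≤ e₁ bd)) ⟩
      N * (e₁ + 2 * w)                     ≡⟨ *-distribˡ-+ N e₁ (2 * w) ⟩
      N * e₁ + N * (2 * w)                 ≤⟨ +-monoˡ-≤ (N * (2 * w)) (proj₁ inner) ⟩
      a * (x₁ * y₁) + m * m + N * (2 * w)
        ≤⟨ +-mono-≤ (+-monoˡ-≤ (m * m) (*-monoʳ-≤ a (*-mono-≤ (size-mono (∩⊑ˡ X W)) (size-mono (∩⊑ˡ Y W′))))) (2w≤4w N w) ⟩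
      a * (size X * size Y) + m * m + 4 * (N * w) ≡⟨ +-assoc (a * (size X * size Y)) (m * m) (4 * (N * w)) ⟩
      a * (size X * size Y) + (m * m + 4 * (N * w)) ∎) ,
    (begin
      a * (size X * size Y)                ≤⟨ *-monoʳ-≤ a (≤-trans (area-trim X Y W W′) (+-monoʳ-≤ (x₁ * y₁) bd)) ⟩
      a * (x₁ * y₁ + 2 * w)                ≡⟨ *-distribˡ-+ a (x₁ * y₁) (2 * w) ⟩
      a * (x₁ * y₁) + a * (2 * w)          ≤⟨ +-mono-≤ (proj₂ inner) (*-monoˡ-≤ (2 * w) a≤2N) ⟩
      N * e₁ + m * m + 2 * N * (2 * w)
        ≤⟨ +-mono-≤ (+-monoˡ-≤ (m * m) (*-monoʳ-≤ N (e-mono f (∩⊑ˡ X W) (∩⊑ˡ Y W′)))) (≤-reflexive (l₁ N w)) ⟩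
      N * e[ f ] X Y + m * m + 4 * (N * w) ≡⟨ +-assoc (N * e[ f ] X Y) (m * m) (4 * (N * w)) ⟩
      N * e[ f ] X Y + (m * m + 4 * (N * w)) ∎)
  where
  open ≤-Reasoning
  w = t * (s + t)
  e₁ = e[ f ] (X ∩ W) (Y ∩ W′)
  x₁ = size (X ∩ W)
  y₁ = size (Y ∩ W′)
  inner = reg (X ∩ W) (Y ∩ W′) (λ x u → W⊑U₀ x (∧-elimʳ {X x} u)) (λ y u → W′⊑V₀ y (∧-elimʳ {Y y} u))
  bd : size (X ∖ W) * size Y + size X * size (Y ∖ W′) ≤ 2 * w
  bd = boundary-bound (size-∖-mono X⊑U W⊑U W≡s U≡) (≤-trans (size-mono Y⊑V) (≤-reflexive V≡))
    (≤-trans (size-mono X⊑U) (≤-reflexive U≡)) (size-∖-mono Y⊑V W′⊑V W′≡s V≡)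
  l₁ : ∀ N w → 2 * N * (2 * w) ≡ 4 * (N * w)
  l₁ = solve-∀
  2w≤4w : ∀ N w → N * (2 * w) ≤ 4 * (N * w)
  2w≤4w N w = ≤-trans (m≤m+n _ (N * (2 * w))) (≤-reflexive (l₂ N w))
    where
    l₂ : ∀ N w → N * (2 * w) + N * (2 * w) ≡ 4 * (N * w)
    l₂ = solve-∀

-- Multiplied by `E′`, the error inherited from the old classes and the one from the added vertices
-- are each at most `N μ² / 4`. This fixes the factor 16, both in `N` and in the bound on `t`.
error-bound : ∀ {E′ L m t μ} → m ≤ 2 * (L * μ) → 16 * E′ * t ≤ μ →
  let N = 16 * E′ * (L * L) in 2 * (E′ * (m * m + 4 * (N * (t * μ)))) ≤ N * (μ * μ)
error-bound {E′} {L} {m} {t} {μ} m≤ t≤ = *-cancelˡ-≤ 8 (begin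
  8 * (2 * (E′ * (m * m + 4 * (N * (t * μ)))))                       ≡⟨ l₁ E′ (m * m) N t μ ⟩
  16 * E′ * (m * m) + 4 * N * (16 * E′ * t * μ)
    ≤⟨ +-mono-≤ (*-monoʳ-≤ (16 * E′) (*-mono-≤ m≤ m≤)) (*-monoʳ-≤ (4 * N) (*-monoˡ-≤ μ t≤)) ⟩
  16 * E′ * (2 * (L * μ) * (2 * (L * μ))) + 4 * N * (μ * μ)          ≡⟨ cong (_+ 4 * N * (μ * μ)) (l₂ (16 * E′) L μ) ⟩
  4 * N * (μ * μ) + 4 * N * (μ * μ)                                  ≡⟨ l₃ N (μ * μ) ⟩
  8 * (N * (μ * μ))                                                  ∎)
  where
  open ≤-Reasoning
  N = 16 * E′ * (L * L)
  l₁ : ∀ E m N t μ → 8 * (2 * (E * (m + 4 * (N * (t * μ))))) ≡ 16 * E * m + 4 * N * (16 * E * t * μ)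
  l₁ = solve-∀
  l₂ : ∀ c L μ → c * (2 * (L * μ) * (2 * (L * μ))) ≡ 4 * (c * (L * L)) * (μ * μ)
  l₂ = solve-∀
  l₃ : ∀ N w → 4 * N * w + 4 * N * w ≡ 8 * (N * w)
  l₃ = solve-∀

-- P, P′ stand for e(X,Y)|U||V| and e(U,V)|X||Y| in either order, with |X||Y| = S and |U||V| = A.
close-arith : ∀ {E N Q S A P P′} → 1 ≤ N → 1 ≤ S → 1 ≤ A → A ≤ E * E * S →
  2 * (E * suc (E * E) * Q) ≤ N * A → N * P ≤ N * P′ + (Q * S + Q * A) → E * P < E * P′ + S * A
close-arith {E} {N} {Q} {S} {A} {P} {P′} 1≤N 1≤S 1≤A A≤ Q≤ NP≤ = *-cancelˡ-< 2 _ _ (begin-strict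
  2 * (E * P)                    ≤⟨ *-cancelˡ-≤ N {{>-nonZero 1≤N}} scaled ⟩
  2 * (E * P′) + S * A           <⟨ m<m+n _ (*-mono-≤ 1≤S 1≤A) ⟩
  2 * (E * P′) + S * A + S * A   ≡⟨ l₁ (E * P′) (S * A) ⟩
  2 * (E * P′ + S * A)           ∎)
  where
  open ≤-Reasoning
  l₁ : ∀ a b → 2 * a + b + b ≡ 2 * (a + b)
  l₁ = solve-∀
  l₂ : ∀ N E P → N * (2 * (E * P)) ≡ 2 * E * (N * P)
  l₂ = solve-∀
  l₃ : ∀ E N P Q S → 2 * E * (N * P + (Q * S + Q * (E * E * S))) ≡ N * (2 * (E * P)) + 2 * (E * suc (E * E) * Q) * S
  l₃ = solve-∀
  l₄ : ∀ N a S A → N * a + N * A * S ≡ N * (a + S * A)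
  l₄ = solve-∀
  -- By `A ≤ E * E * S` the two errors together are at most `Q * suc (E * E) * S`, hence this factor
  -- in the hypothesis on `Q`. Only half of `S * A` is consumed, and the other half makes the result
  -- strict.
  scaled : N * (2 * (E * P)) ≤ N * (2 * (E * P′) + S * A)
  scaled = begin
    N * (2 * (E * P))                                              ≡⟨ l₂ N E P ⟩
    2 * E * (N * P)                                                ≤⟨ *-monoʳ-≤ (2 * E) NP≤ ⟩
    2 * E * (N * P′ + (Q * S + Q * A))
      ≤⟨ *-monoʳ-≤ (2 * E) (+-monoʳ-≤ (N * P′) (+-monoʳ-≤ (Q * S) (*-monoʳ-≤ Q A≤))) ⟩
    2 * E * (N * P′ + (Q * S + Q * (E * E * S)))                   ≡⟨ l₃ E N P′ Q S ⟩
    N * (2 * (E * P′)) + 2 * (E * suc (E * E) * Q) * S             ≤⟨ +-monoʳ-≤ (N * (2 * (E * P′))) (*-monoˡ-≤ S Q≤) ⟩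
    N * (2 * (E * P′)) + N * A * S                                 ≡⟨ l₄ N (2 * (E * P′)) S A ⟩
    N * (2 * (E * P′) + S * A)                                     ∎

eBetween≡e : (G : Graph n) → ∀ X Y → eBetween G X Y ≡ e[ adj G ] (lookup X) (lookup Y)
eBetween≡e {n} G X Y = countᵇ-allPairs n _

eIn≤e : (G : Graph n) → ∀ U → eIn G U ≤ e[ adj G ] (lookup U) (lookup U)
eIn≤e {n} G U = ≤-trans (≤-reflexive (countᵇ-allPairs n _))
  (∑∑-mono λ x y → 𝟙-mono (drop (lookup U x) (lookup U y) (F.toℕ x <ᵇ F.toℕ y)))
  where
  drop : ∀ a b c {d} → a ∧ b ∧ c ∧ d ≡ true → a ∧ b ∧ d ≡ true
  drop true true true h = h

-- The densities of `(X , Y)` and of `(A , B)` are both compared with `a / N`, which cancels after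
-- cross-multiplication.
near⇒Uniform : ∀ {ε} (σ : Scale ε) (G : Graph n) N a Q μ (A B : Subset n) → let E = Scale.E σ in
  1 ≤ N → 1 ≤ μ → card A ≡ μ → card B ≡ μ → 2 * (E * suc (E * E) * Q) ≤ N * (μ * μ) →
  Near (adj G) N a Q (lookup A) (lookup B) → Uniform G ε A B
near⇒Uniform σ G N a Q μ A B 1≤N 1≤μ A≡ B≡ Q≤ near X Y X⊆A Y⊆B X-large Y-large
  rewrite eBetween≡e G X Y | eBetween≡e G A B | A≡ | B≡
  = close eX (card X * card Y) eA (μ * μ) 1≤S (*-mono-≤ 1≤μ 1≤μ)
      (close-arith {E} {N} {Q} 1≤N 1≤S (*-mono-≤ 1≤μ 1≤μ) area Q≤ (begin
        N * (eX * (μ * μ))                            ≡⟨ *-assoc N eX _ ⟨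
        N * eX * (μ * μ)                              ≤⟨ *-monoˡ-≤ (μ * μ) (proj₁ nearX) ⟩
        (a * S + Q) * (μ * μ)                         ≡⟨ l₁ a S Q (μ * μ) ⟩
        a * (μ * μ) * S + Q * (μ * μ)                 ≤⟨ +-monoˡ-≤ (Q * (μ * μ)) (*-monoˡ-≤ S (proj₂ nearA)) ⟩
        (N * eA + Q) * S + Q * (μ * μ)                ≡⟨ l₂ N eA Q S (Q * (μ * μ)) ⟩
        N * (eA * S) + (Q * S + Q * (μ * μ))          ∎))
      (close-arith {E} {N} {Q} 1≤N 1≤S (*-mono-≤ 1≤μ 1≤μ) area Q≤ (begin
        N * (eA * S)                                  ≡⟨ *-assoc N eA _ ⟨
        N * eA * S                                    ≤⟨ *-monoˡ-≤ S (proj₁ nearA) ⟩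
        (a * (μ * μ) + Q) * S                         ≡⟨ l₁ a (μ * μ) Q S ⟩
        a * S * (μ * μ) + Q * S                       ≤⟨ +-monoˡ-≤ (Q * S) (*-monoˡ-≤ (μ * μ) (proj₂ nearX)) ⟩
        (N * eX + Q) * (μ * μ) + Q * S                ≡⟨ l₃ N eX Q (μ * μ) (Q * S) ⟩
        N * (eX * (μ * μ)) + (Q * S + Q * (μ * μ))    ∎))
  where
  open Scale σ
  open ≤-Reasoning
  eX = e[ adj G ] (lookup X) (lookup Y)
  eA = e[ adj G ] (lookup A) (lookup B)
  S = card X * card Y
  μ≤EX : μ ≤ E * card X
  μ≤EX = ≤-elim (card X) μ X-large
  μ≤EY : μ ≤ E * card Y
  μ≤EY = ≤-elim (card Y) μ Y-large
  positive : ∀ {x} → μ ≤ E * x → 1 ≤ x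
  positive {zero}  h = contradiction (≤-trans 1≤μ (≤-trans h (≤-reflexive (*-zeroʳ E)))) λ ()
  positive {suc x} h = s≤s z≤n
  1≤S : 1 ≤ S
  1≤S = *-mono-≤ (positive μ≤EX) (positive μ≤EY)
  area : μ * μ ≤ E * E * S
  area = ≤-trans (*-mono-≤ μ≤EX μ≤EY) (≤-reflexive (l E (card X) (card Y)))
    where
    l : ∀ E x y → E * x * (E * y) ≡ E * E * (x * y)
    l = solve-∀
  nearX : N * eX ≤ a * S + Q × a * S ≤ N * eX + Q
  nearX = subst₂ (λ x y → N * eX ≤ a * (x * y) + Q × a * (x * y) ≤ N * eX + Q) (sym (card≡size X)) (sym (card≡size Y))
    (near (lookup X) (lookup Y) (λ x t → []=⇒lookup (X⊆A (lookup⇒[]= x X t))) (λ y t → []=⇒lookup (Y⊆B (lookup⇒[]= y Y t))))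
  nearA : N * eA ≤ a * (μ * μ) + Q × a * (μ * μ) ≤ N * eA + Q
  nearA = subst₂ (λ x y → N * eA ≤ a * (x * y) + Q × a * (x * y) ≤ N * eA + Q)
    (trans (sym (card≡size A)) A≡) (trans (sym (card≡size B)) B≡)
    (near (lookup A) (lookup B) (λ _ t → t) (λ _ t → t))
  l₁ : ∀ a S Q A → (a * S + Q) * A ≡ a * A * S + Q * A
  l₁ = solve-∀
  l₂ : ∀ N e Q S w → (N * e + Q) * S + w ≡ N * (e * S) + (Q * S + w)
  l₂ = solve-∀
  l₃ : ∀ N e Q A w → (N * e + Q) * A + w ≡ N * (e * A) + (w + Q * A)
  l₃ = solve-∀

*-^-distrib : ∀ a b r → (a * b) ^ r ≡ a ^ r * b ^ r
*-^-distrib a b zero    = refl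
*-^-distrib a b (suc r) = trans (cong (a * b *_) (*-^-distrib a b r)) (l₁ a b (a ^ r) (b ^ r))
  where
  l₁ : ∀ a b c d → a * b * (c * d) ≡ a * c * (b * d)
  l₁ = solve-∀

-- Half of the allowance is spent on the pairs inside `W`, the other half on the at most
-- `2 t (s + t)` pairs that contain an added vertex.
sparse-thicken : ∀ {f : Fin n → Fin n → Bool} {E s t U W} → W ⊑ U → size W ≡ s → size U ≡ s + t →
  8 * E * e[ f ] W W ≤ s * s → 16 * E * t ≤ s + t → 4 * (E * e[ f ] U U) ≤ (s + t) * (s + t)
sparse-thicken {f = f} {E} {s} {t} {U} {W} W⊑U W≡s U≡ sparse t≤ = *-cancelˡ-≤ 2 (begin
  2 * (4 * (E * e[ f ] U U))                        ≡⟨ l₁ E (e[ f ] U U) ⟩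
  8 * E * e[ f ] U U
    ≤⟨ *-monoʳ-≤ (8 * E) (≤-trans (e-trim U U W W f) (+-mono-≤ (e-mono f (λ x → ∧-elimʳ {U x}) (λ x → ∧-elimʳ {U x})) bd)) ⟩
  8 * E * (e[ f ] W W + 2 * (t * μ))                ≡⟨ l₂ E (e[ f ] W W) t μ ⟩
  8 * E * e[ f ] W W + 16 * E * t * μ
    ≤⟨ +-mono-≤ (≤-trans sparse (*-mono-≤ (m≤m+n s t) (m≤m+n s t))) (*-monoˡ-≤ μ t≤) ⟩
  μ * μ + μ * μ                                     ≡⟨ cong (_+_ (μ * μ)) (+-identityʳ (μ * μ)) ⟨
  2 * (μ * μ)                                       ∎)
  where
  open ≤-Reasoning
  μ = s + t
  U∖W≤t : size (U ∖ W) ≤ t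
  U∖W≤t = size-∖-mono {X = U} {U = U} (λ _ u → u) W⊑U W≡s U≡
  bd : size (U ∖ W) * size U + size U * size (U ∖ W) ≤ 2 * (t * μ)
  bd = boundary-bound U∖W≤t (≤-reflexive U≡) (≤-reflexive U≡) U∖W≤t
  l₁ : ∀ E e → 2 * (4 * (E * e)) ≡ 8 * E * e
  l₁ = solve-∀
  l₂ : ∀ E e t μ → 8 * E * (e + 2 * (t * μ)) ≡ 8 * E * e + 16 * E * t * μ
  l₂ = solve-∀

-- Choice of the constants and construction of the final partition

module Assembly (E r k : ℕ) (1≤E : 1 ≤ E) (1≤k : 1 ≤ k) where

  -- `E′` is the loss in `close-arith`. At most a fraction `1 / F` is added to each class, for which
  -- `leftover-small` needs `suc B₁ = 4 * suc F`. Of the `L = H + M` pieces that would fit into an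
  -- old class, `H` are cut out, and `M` remain as the reserve for `sparse-set`. The summand `k` in
  -- `M` produces at least `k` classes. `N` is dictated by `error-bound`.
  E′ F B₁ M L H N : ℕ
  E′ = E * suc (E * E)
  F  = 16 * E′
  B₁ = 3 + 4 * F
  M  = sparseM (8 * E) r + k
  L  = M * suc B₁
  H  = M * B₁
  N  = 16 * E′ * (L * L)

  E≤E′ : E ≤ E′
  E≤E′ = m≤m*n E (suc (E * E))

  k≤M : k ≤ M
  k≤M = m≤n+m k (sparseM (8 * E) r)

  k≤H : k ≤ H
  k≤H = ≤-trans k≤M (m≤m*n M B₁)

  instance
    L≢0 : NonZero L
    L≢0 = m*n≢0 M (suc B₁) {{>-nonZero (≤-trans 1≤k k≤M)}}

  1≤N : 1 ≤ N
  1≤N = *-mono-≤ {1} {16 * E′} {1} {L * L} (*-mono-≤ {1} {16} (s≤s z≤n) (≤-trans 1≤E E≤E′))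
    (*-mono-≤ {1} {L} (>-nonZero⁻¹ L) (>-nonZero⁻¹ L))

  record Good (G : Graph n) (K : ℕ) : Set where
    field
      ℓ       : ℕ
      k≤ℓ     : k ≤ ℓ
      ℓ≤K     : ℓ ≤ K
      part    : Fin n → Fin (suc ℓ)
      μ       : ℕ
      2≤μ     : 2 ≤ μ
      sizes   : ∀ i → size (cls part (suc i)) ≡ μ
      rest    : size (cls part zero) < ℓ
      bad     : Fin ℓ → Fin ℓ → Bool
      few     : E * ∑∑ (λ i j → 𝟙 (bad i j)) ≤ ℓ * ℓ
      sparse  : ∀ i → 4 * (E * e[ adj G ] (cls part (suc i)) (cls part (suc i))) ≤ μ * μ
      uniform : ∀ i j → bad i j ≡ false → ∃ λ a → ∃ λ Q → 2 * (E′ * Q) ≤ N * (μ * μ) ×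
                  Near (adj G) N a Q (cls part (suc i)) (cls part (suc j))

  module Construction (G : Graph n) (K₀ : ℕ) {q₀ : ℕ} (S : State (adj G) N q₀) (q₀≤K₀ : q₀ ≤ K₀)
    (few : E * State.#bad S ≤ q₀ * q₀) (small : 2 * suc F * State.exceptional S ≤ n)
    (large : suc B₁ * (K₀ * L) < n)
    (few-cliques : 2 * (r ! * (4 * (K₀ * L)) ^ r) * k[ r ] G ≤ n ^ r) where

    open State S renaming (part to part₀; bad to bad₀; sizes to sizes₀; exceptional to z₀)
    open ≤-Reasoning

    s Z : ℕ
    s = m / L
    Z = 4 * (K₀ * L)

    n≤2q₀m : n ≤ 2 * (q₀ * m)
    n≤2q₀m = majority {z = z₀} {w = q₀ * m} n≡ (≤-trans (*-monoˡ-≤ z₀ (m≤m*n 2 (suc F))) small)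

    m≡ : m ≡ m % L + L * s
    m≡ = trans (m≡m%n+[m/n]*n m L) (cong (m % L +_) (*-comm s L))

    Ls≤m : L * s ≤ m
    Ls≤m = ≤-trans (m≤n+m (L * s) (m % L)) (≤-reflexive (sym m≡))

    m<Ls+L : m < L * s + L
    m<Ls+L = ≤-trans (≤-reflexive (cong suc (trans m≡ (+-comm (m % L) _))))
      (≤-trans (≤-reflexive (sym (+-suc (L * s) (m % L)))) (+-monoʳ-≤ (L * s) (m%n<n m L)))

    -- Smaller classes would force `n ≤ 4 * (K₀ * L)`. The factor 2 is what gives `s` at least two
    -- vertices.
    2L≤m : 2 * L ≤ m
    2L≤m = ≮⇒≥ λ m<2L → <⇒≱ large (begin
      n                        ≤⟨ n≤2q₀m ⟩
      2 * (q₀ * m)             ≤⟨ *-monoʳ-≤ 2 (*-mono-≤ q₀≤K₀ (<⇒≤ m<2L)) ⟩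
      2 * (K₀ * (2 * L))       ≡⟨ l₁ K₀ L ⟩
      4 * (K₀ * L)             ≤⟨ *-monoˡ-≤ (K₀ * L) (m≤m+n 4 (4 * F)) ⟩
      suc B₁ * (K₀ * L)        ∎)
      where
      l₁ : ∀ K L → 2 * (K * (2 * L)) ≡ 4 * (K * L)
      l₁ = solve-∀

    2≤s : 2 ≤ s
    2≤s = ≮⇒≥ λ { (s≤s s≤1) → <⇒≱ m<Ls+L (begin
      L * s + L   ≤⟨ +-monoˡ-≤ L (≤-trans (*-monoʳ-≤ L s≤1) (≤-reflexive (*-identityʳ L))) ⟩
      L + L       ≡⟨ cong (L +_) (+-identityʳ L) ⟨
      2 * L       ≤⟨ 2L≤m ⟩
      m           ∎) }

    1≤s : 1 ≤ s
    1≤s = ≤-trans (n≤1+n 1) 2≤s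

    m≤2Ls : m ≤ 2 * (L * s)
    m≤2Ls = begin
      m                 ≤⟨ <⇒≤ m<Ls+L ⟩
      L * s + L         ≤⟨ +-monoʳ-≤ (L * s) (m≤m*n L s {{>-nonZero 1≤s}}) ⟩
      L * s + L * s     ≡⟨ cong (L * s +_) (+-identityʳ (L * s)) ⟨
      2 * (L * s)       ∎

    1≤m : 1 ≤ m
    1≤m = ≤-trans (*-mono-≤ {1} {2} (s≤s z≤n) (>-nonZero⁻¹ L)) 2L≤m

    n≤Zs : n ≤ Z * s
    n≤Zs = begin
      n                        ≤⟨ n≤2q₀m ⟩
      2 * (q₀ * m)             ≤⟨ *-monoʳ-≤ 2 (*-mono-≤ q₀≤K₀ m≤2Ls) ⟩
      2 * (K₀ * (2 * (L * s))) ≡⟨ l₁ K₀ L s ⟩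
      Z * s                    ∎
      where
      l₁ : ∀ K L s → 2 * (K * (2 * (L * s))) ≡ 4 * (K * L) * s
      l₁ = solve-∀

    1≤n : 1 ≤ n
    1≤n = ≤-trans (s≤s z≤n) large

    Z≢0 : NonZero Z
    Z≢0 = ≢-nonZero λ Z≡0 → <⇒≱ 1≤n (≤-trans n≤Zs (≤-reflexive (cong (_* s) Z≡0)))

    q₀≢0 : NonZero q₀
    q₀≢0 = ≢-nonZero λ q₀≡0 → <⇒≱ 1≤n (≤-trans n≤2q₀m (≤-reflexive (cong (λ w → 2 * (w * m)) q₀≡0)))

    -- `n ≤ Z * s` with `Z` independent of `n` turns a bound by `n ^ r` into one by `s ^ r`, at the
    -- price of the factor `Z ^ r`.
    cliques-small : ∀ R → 2 * cliques G r R ≤ s ^ r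
    cliques-small R = *-cancelˡ-≤ (Z ^ r) {{m^n≢0 Z r {{Z≢0}}}} (begin
      Z ^ r * (2 * cliques G r R)         ≤⟨ *-monoʳ-≤ (Z ^ r) (*-monoʳ-≤ 2 (cliques≤k G r R)) ⟩
      Z ^ r * (2 * (r ! * k[ r ] G))      ≡⟨ l₁ (Z ^ r) (r !) (k[ r ] G) ⟩
      2 * (r ! * Z ^ r) * k[ r ] G        ≤⟨ few-cliques ⟩
      n ^ r                               ≤⟨ ^-monoˡ-≤ r n≤Zs ⟩
      (Z * s) ^ r                         ≡⟨ *-^-distrib Z s r ⟩
      Z ^ r * s ^ r                       ∎)
      where
      l₁ : ∀ a b c → a * (2 * (b * c)) ≡ 2 * (b * a) * c
      l₁ = solve-∀

    Sparse : Fin q₀ → VSet n → Set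
    Sparse _ W = 8 * E * e[ adj G ] W W ≤ s * s

    sparse-pieces : ∃ λ (part₁ : Fin n → Fin (suc (q₀ * H))) → ∀ J →
      Piece (cls part₀ (suc (quotient H J))) s (Sparse (quotient H J)) (cls part₁ (suc J))
    sparse-pieces = refine part₀ H (M * s) s Sparse
      (λ _ W′⊑W → ≤-trans (*-monoʳ-≤ (8 * E) (e-mono (adj G) W′⊑W W′⊑W)))
      (λ i R _ big → let W , W⊑ , W≡s , sp = sparse-set G (8 * E) r R s 1≤s
                           (≤-trans (*-monoˡ-≤ s (m≤m+n (sparseM (8 * E) r) k)) big) (cliques-small R)
                     in W , W≡s , W⊑ , sp)
      (λ i → begin
        M * s + H * s                ≡⟨ l₁ M B₁ s ⟩
        L * s                        ≤⟨ Ls≤m ⟩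
        m                            ≡⟨ sizes₀ i ⟨
        size (cls part₀ (suc i))     ≤⟨ m≤m+n _ s ⟩
        size (cls part₀ (suc i)) + s ∎)
      where
      l₁ : ∀ M b s → M * s + M * b * s ≡ M * suc b * s
      l₁ = solve-∀

    ℓ : ℕ
    ℓ = q₀ * H

    k≤ℓ : k ≤ ℓ
    k≤ℓ = ≤-trans k≤H (m≤n*m H q₀ {{q₀≢0}})

    instance
      ℓ≢0 : NonZero ℓ
      ℓ≢0 = >-nonZero (≤-trans 1≤k k≤ℓ)

    -- The old exceptional class and the cutting contribute `2 n` each to `suc B₁ * z₁`, so
    -- `suc F * z₁ ≤ n = z₁ + ℓ * s`.
    leftover-small : ∀ z₁ → n ≡ z₁ + ℓ * s → F * z₁ ≤ ℓ * s
    leftover-small z₁ n≡′ = +-cancelˡ-≤ z₁ _ _ (*-cancelˡ-≤ 4 (begin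
      4 * (z₁ + F * z₁)                        ≡⟨ l₁ F z₁ ⟩
      suc B₁ * z₁                              ≤⟨ leftover-bound {q = q₀} {m = m} {s = s} M B₁ n≡ n≡′ Ls≤m (<⇒≤ m<Ls+L)
                                                    (≤-trans (*-monoʳ-≤ (suc B₁) (*-monoˡ-≤ L q₀≤K₀)) (<⇒≤ large)) ⟩
      suc B₁ * z₀ + 2 * n                      ≡⟨ cong (_+ 2 * n) (l₂ F z₀) ⟩
      2 * (2 * suc F * z₀) + 2 * n             ≤⟨ +-monoˡ-≤ (2 * n) (*-monoʳ-≤ 2 small) ⟩
      2 * n + 2 * n                            ≡⟨ l₃ n ⟩
      4 * n                                    ≡⟨ cong (4 *_) n≡′ ⟩
      4 * (z₁ + ℓ * s)                         ∎))
      where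
      l₁ : ∀ F z → 4 * (z + F * z) ≡ (4 + 4 * F) * z
      l₁ = solve-∀
      l₂ : ∀ F z → (4 + 4 * F) * z ≡ 2 * (2 * suc F * z)
      l₂ = solve-∀
      l₃ : ∀ n → 2 * n + 2 * n ≡ 4 * n
      l₃ = solve-∀

    module _ (part₁ : Fin n → Fin (suc ℓ)) (piece : ∀ J →
      Piece (cls part₀ (suc (quotient H J))) s (Sparse (quotient H J)) (cls part₁ (suc J))) where

      z₁ t : ℕ
      z₁ = size (cls part₁ zero)
      -- With this quotient the vertices that cannot be spread evenly number `z₁ % ℓ`, which is the
      -- required bound on the exceptional class.
      t  = z₁ / ℓ

      n≡₁ : n ≡ z₁ + ℓ * s
      n≡₁ = total-size part₁ s (λ J → proj₁ (piece J))

      z₁≡ : z₁ ≡ z₁ % ℓ + ℓ * t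
      z₁≡ = trans (m≡m%n+[m/n]*n z₁ ℓ) (cong (z₁ % ℓ +_) (*-comm t ℓ))

      ℓt≤z₁ : ℓ * t ≤ z₁
      ℓt≤z₁ = ≤-trans (m≤n+m (ℓ * t) (z₁ % ℓ)) (≤-reflexive (sym z₁≡))

      Ft≤s : F * t ≤ s
      Ft≤s = *-cancelˡ-≤ ℓ (begin
        ℓ * (F * t)   ≡⟨ l₁ ℓ F t ⟩
        F * (ℓ * t)   ≤⟨ *-monoʳ-≤ F ℓt≤z₁ ⟩
        F * z₁        ≤⟨ leftover-small z₁ n≡₁ ⟩
        ℓ * s         ∎)
        where
        l₁ : ∀ ℓ F t → ℓ * (F * t) ≡ F * (ℓ * t)
        l₁ = solve-∀

      Ft≤μ : F * t ≤ s + t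
      Ft≤μ = ≤-trans Ft≤s (m≤m+n s t)

      finish : (∃ λ (p : Fin n → Fin (suc ℓ)) → ∀ i → size (cls p (suc i)) ≡ s + t × cls part₁ (suc i) ⊑ cls p (suc i)) →
        Good G (K₀ * H)
      finish (p , thick) = record
        { ℓ = ℓ ; k≤ℓ = k≤ℓ ; ℓ≤K = *-monoˡ-≤ H q₀≤K₀ ; part = p ; μ = s + t ; 2≤μ = ≤-trans 2≤s (m≤m+n s t)
        ; sizes = λ i → proj₁ (thick i)
        ; rest = subst (_< ℓ) (sym rest≡) (m%n<n z₁ ℓ)
        -- Two pieces of the same old class `i` inherit the status of the diagonal pair `(i , i)`.
        -- Every old pair has `H * H` descendants, so the proportion of bad pairs is unchanged.
        ; bad = λ I J → bad₀ (quotient H I) (quotient H J)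
        ; few = few′
        ; sparse = λ i → let W≡s , _ , sp = piece i; U≡ , W⊑U = thick i in
            sparse-thicken {f = adj G} {E} W⊑U W≡s U≡ sp (≤-trans (*-monoˡ-≤ t (*-monoʳ-≤ 16 E≤E′)) Ft≤μ)
        ; uniform = λ I J good →
            let i = quotient H I; j = quotient H J
                W≡s , W⊑ , _ = piece I; U≡ , W⊑U = thick I
                W′≡s , W′⊑ , _ = piece J; V≡ , W′⊑V = thick J
                reg = irregular-false (verdict i j) good in
            value i j , m * m + 4 * (N * (t * (s + t))) ,
            error-bound {E′} {L} (≤-trans m≤2Ls (*-monoʳ-≤ 2 (*-monoʳ-≤ L (m≤m+n s t)))) Ft≤μ ,
            regular-thicken {f = adj G} {N} {value i j} {m} (regular-value-bound {f = adj G} 1≤N 1≤m (sizes₀ i) (sizes₀ j) reg)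
              reg W⊑ W′⊑ W⊑U W′⊑V W≡s W′≡s U≡ V≡
        }
        where
        rest≡ : size (cls p zero) ≡ z₁ % ℓ
        rest≡ = +-cancelʳ-≡ (ℓ * (s + t)) _ _ (trans (sym (total-size p (s + t) λ i → proj₁ (thick i)))
          (trans n≡₁ (trans (cong (_+ ℓ * s) z₁≡) (l₁ (z₁ % ℓ) ℓ s t))))
          where
          l₁ : ∀ a ℓ s t → a + ℓ * t + ℓ * s ≡ a + ℓ * (s + t)
          l₁ = solve-∀
        few′ : E * ∑∑ (λ I J → 𝟙 (bad₀ (quotient H I) (quotient H J))) ≤ ℓ * ℓ
        few′ = begin
          E * ∑∑ (λ I J → 𝟙 (bad₀ (quotient H I) (quotient H J)))  ≡⟨ cong (E *_) (∑∑-quotient q₀ H (λ i j → 𝟙 (bad₀ i j))) ⟩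
          E * (H * H * #bad)                                        ≡⟨ l₁ E (H * H) #bad ⟩
          H * H * (E * #bad)                                        ≤⟨ *-monoʳ-≤ (H * H) few ⟩
          H * H * (q₀ * q₀)                                         ≡⟨ l₂ H q₀ ⟩
          ℓ * ℓ                                                     ∎
          where
          l₁ : ∀ a b c → a * (b * c) ≡ b * (a * c)
          l₁ = solve-∀
          l₂ : ∀ H q → H * H * (q * q) ≡ q * H * (q * H)
          l₂ = solve-∀

    good : Good G (K₀ * H)
    good = let part₁ , piece = sparse-pieces in
      finish part₁ piece (distribute part₁ s (t part₁ piece) (λ J → proj₁ (piece J)) (ℓt≤z₁ part₁ piece))

-- Return to the notions of the statement

lookup-class : (p : Fin n → Fin (suc q)) → ∀ c x → lookup (classOf p c) x ≡ cls p c x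
lookup-class p c = lookup∘tabulate (cls p c)

card-class : (p : Fin n → Fin (suc q)) → ∀ c → card (classOf p c) ≡ size (cls p c)
card-class p c = trans (card≡size (classOf p c)) (size-cong (lookup-class p c))

class⊑ : (p : Fin n → Fin (suc q)) → ∀ c → lookup (classOf p c) ⊑ cls p c
class⊑ p c x t = trans (sym (lookup-class p c x)) t

Conclusion : ℚ → ℕ → ℕ → Graph n → Set
Conclusion {n} ε k K G = Σ ℕ (λ q → k ≤ q × q ≤ K × Σ (Fin n → Fin (suc q)) (λ part →
  UniformPartition G ε part ×
  ((i : Fin q) → ℕ→ℚ (eIn G (part[ part ] i)) ≤ℚ ε *ℚ ℕ→ℚ (card (part[ part ] i) C 2))))

module _ {ε : ℚ} (σ : Scale ε) (r k : ℕ) (1≤k : 1 ≤ k) where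
  open Scale σ
  open Assembly E r k 1≤E 1≤k

  good⇒conclusion : ∀ {K} (G : Graph n) → Good G K → Conclusion ε k K G
  good⇒conclusion {n} G g = ℓ , k≤ℓ , ℓ≤K , part ,
    ((subst (_< ℓ) (sym (card-class part zero)) rest , μ , 1≤μ , cards) ,
     bad , ≤-intro _ (ℓ * ℓ) bad-few ,
     λ i j _ ok → let a , Q , Q≤ , near = uniform i j ok in
       near⇒Uniform σ G N a Q μ _ _ 1≤N 1≤μ (cards i) (cards j) Q≤
         (λ X Y X⊑ Y⊑ → near X Y (λ x t → class⊑ part (suc i) x (X⊑ x t)) (λ y t → class⊑ part (suc j) y (Y⊑ y t)))) ,
    λ i → ≤-intro (eIn G (part[ part ] i)) _ (edges i)
    where
    open Good g
    open ≤-Reasoning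
    1≤μ : 1 ≤ μ
    1≤μ = ≤-trans (n≤1+n 1) 2≤μ
    cards : ∀ i → card (part[ part ] i) ≡ μ
    cards i = trans (card-class part (suc i)) (sizes i)
    bad-few : E * countᵇ (λ { (i , j) → (F.toℕ i <ᵇ F.toℕ j) ∧ bad i j }) (allPairs ℓ) ≤ ℓ * ℓ
    bad-few = begin
      E * countᵇ (λ { (i , j) → (F.toℕ i <ᵇ F.toℕ j) ∧ bad i j }) (allPairs ℓ) ≡⟨ cong (E *_) (countᵇ-allPairs ℓ _) ⟩
      E * ∑∑ (λ i j → 𝟙 ((F.toℕ i <ᵇ F.toℕ j) ∧ bad i j))
        ≤⟨ *-monoʳ-≤ E (∑∑-mono λ i j → 𝟙-mono (∧-elimʳ {F.toℕ i <ᵇ F.toℕ j})) ⟩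
      E * ∑∑ (λ i j → 𝟙 (bad i j))                           ≤⟨ few ⟩
      ℓ * ℓ                                                  ∎
    edges : ∀ i → E * eIn G (part[ part ] i) ≤ card (part[ part ] i) C 2
    edges i = subst (λ w → E * eIn G (part[ part ] i) ≤ w C 2) (sym (cards i)) (*-cancelˡ-≤ 4 (begin
      4 * (E * eIn G (part[ part ] i))
        ≤⟨ *-monoʳ-≤ 4 (*-monoʳ-≤ E (≤-trans (eIn≤e G (part[ part ] i))
             (e-mono (adj G) (class⊑ part (suc i)) (class⊑ part (suc i))))) ⟩
      4 * (E * e[ adj G ] (cls part (suc i)) (cls part (suc i)))
        ≤⟨ sparse i ⟩
      μ * μ
        ≤⟨ n²≤4*C2 μ 2≤μ ⟩
      4 * (μ C 2) ∎))

  conclusion : (∃ λ K₀ → ∃ λ n₀ → ∀ {n} (f : Fin n → Fin n → Bool) → n₀ ≤ n →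
      ∃ λ q → q ≤ K₀ × Σ (State f N q) λ S → E * State.#bad S ≤ q * q × 2 * suc F * State.exceptional S ≤ n) →
    Σ ℚ (λ ρ → Positive ρ × Σ ℕ (λ K → Σ ℕ (λ n₀ →
      (n : ℕ) → n₀ ≤ n → (G : Graph n) → ℕ→ℚ (k[ r ] G) ≤ℚ ρ *ℚ ℕ→ℚ (n ^ r) → Conclusion ε k K G)))
  conclusion (K₀ , n₀ , reg) = unit-fraction R , _ , K₀ * H , n₀ ⊔ suc (suc B₁ * (K₀ * L)) , λ n large G few-cliques →
    let q₀ , q₀≤K₀ , S , few , small = reg (adj G) (≤-trans (m≤m⊔n n₀ _) large) in
    good⇒conclusion G (Construction.good G K₀ S q₀≤K₀ few small (≤-trans (m≤n⊔m n₀ _) large)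
      (≤-trans (m≤n+m (R * k[ r ] G) (k[ r ] G)) (≤unit-fraction-elim R (k[ r ] G) (n ^ r) few-cliques)))
    where
    -- The factor 2 comes from `sparse-set`, `r !` from the orderings of a clique, and the power
    -- from `n ≤ Z * s` in `cliques-small`.
    R = 2 * (r ! * (4 * (K₀ * L)) ^ r)

theorem12 : (ε : ℚ) → Positive ε → (r k : ℕ) → 2 ≤ r → 2 ≤ k →
    Σ ℚ (λ ρ → Positive ρ × Σ ℕ (λ K → Σ ℕ (λ n₀ →
    (n : ℕ) → n₀ ≤ n → (G : Graph n) →
    ℕ→ℚ (k[ r ] G) ≤ℚ ρ *ℚ ℕ→ℚ (n ^ r) →
    Σ ℕ (λ q → k ≤ q × q ≤ K × Σ (Fin n → Fin (suc q)) (λ part →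
    UniformPartition G ε part ×
    ((i : Fin q) → ℕ→ℚ (eIn G (part[ part ] i)) ≤ℚ ε *ℚ ℕ→ℚ (card (part[ part ] i) C 2)))))))
theorem12 ε pos r k _ 2≤k = conclusion σ r k 1≤k (regularity N (Scale.E σ) (suc F))
  where
  σ = scale ε pos
  1≤k = ≤-trans (n≤1+n 1) 2≤k
  open Assembly (Scale.E σ) r k (Scale.1≤E σ) 1≤k using (N; F)
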